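{- Over the class of all Kripke trees: $\mathrm{MSO}<\mathrm{coWMSO}$ and $\mathrm{WMSO}<\mathrm{coWMSO}$. Over the class of finitely-branching Kripke trees: $\mathrm{MSO}\equiv\mathrm{coWMSO}$ and $\mathrm{WMSO}<\mathrm{coWMSO}$.
   Context: Trees. A tree $T$ is a subset of $\mathbb{N}^*$ (finite words over the naturals) with an element $\tau_0\in T$ (the root) such that every $\tau\in T$ has the form $\tau_0\cdot\tau'$ with $\tau'\in\mathbb{N}^*$, and whenever $\tau_0\cdot\tau\in T$ and $\tau'$ is a prefix of $\tau$, also $\tau_0\cdot\tau'\in T$. Elements of $T$ are nodes. A child of $\tau$ in $T$ is a node of $T$ of the form $\tau\cdot n$, $n\in\mathbb{N}$; a descendant of $\tau$ in $T$ is a node of $T$ of the form $\tau\cdot\tau'$, $\tau'\in\mathbb{N}^*$ (so $\tau$ is a descendant of itself). $T$ is non-blocking if every node has a child in $T$, and finitely-branching if every node has finitely many children in $T$. For a finite set $AP$ of atomic propositions, a Kripke tree over $AP$ is a pair $(T,\mathrm{Lab})$ with $T$ a non-blocking tree and $\mathrm{Lab}:T\to 2^{AP}$; it is finitely-branching if $T$ is. Logics. Formulas over $AP$ are generated by $\varphi ::= P_a(x)\mid x\le y\mid x\in X\mid \neg\varphi\mid\varphi\wedge\varphi\mid\exists x.\varphi\mid\exists^{\alpha}X.\varphi$, with $a\in AP$, $x,y$ first-order variables, $X$ second-order variables. Over $(T,\mathrm{Lab})$, first-order variables range over nodes of $T$; $P_a(x)$ holds iff $a\in\mathrm{Lab}(x)$;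 $x\le y$ holds iff $y$ is a descendant of $x$ in $T$; $x\in X$ is membership; Boolean connectives and $\exists x$ are standard. The range of second-order quantification determines the logic: in MSO all subsets of $T$; in WMSO all finite subsets of $T$; in coWMSO all infinite subsets of $T$. A logic consists of its sentences (formulas without free variables). Expressiveness. Over a class of Kripke trees, two sentences over the same $AP$ are equivalent if they are satisfied by the same members (over $AP$) of the class. $L\le L'$ means that, for every finite $AP$, each $L$-sentence over $AP$ has an equivalent $L'$-sentence over $AP$. $L\equiv L'$ means $L\le L'$ and $L'\le L$; $L<L'$ means $L\le L'$ and $L'\not\le L$. -}

module Defs where

open import Data.Fin using (Fin)
open import Data.Fin.Subset using (Subset) renaming (_∈_ to _∈ˢ_)
open import Data.List using (List; _++_; _∷ʳ_)
open import Data.List.Membership.Propositional using () renaming (_∈_ to _∈ˡ_)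
open import Data.Nat using (ℕ)
open import Data.Product using (Σ-syntax; ∃-syntax; _×_)
open import Data.Refinement using (Refinement; value)
open import Data.Unit using (⊤)
open import Data.Vec using (Vec; []; _∷_; lookup)
open import Function.Bundles using (_⇔_)
open import Level using (Lift; 0ℓ) renaming (suc to lsuc)
open import Relation.Binary.PropositionalEquality using (_≡_)
open import Relation.Nullary using (¬_)
open import Relation.Unary using (Pred; _∈_; U)

private
  variable
    k m n : ℕ

Word : Set
Word = List ℕ

infix 4 _⊑_

_⊑_ : Word → Word → Set
σ ⊑ τ = ∃[ ρ ] τ ≡ σ ++ ρ

record Tree : Set₁ where
  field
    Nodes         : Pred Word 0ℓ
    root          : Word
    root∈         : root ∈ Nodes
    rooted        : ∀ τ → τ ∈ Nodes → root ⊑ τ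
    prefix-closed : ∀ τ τ′ → (root ++ τ) ∈ Nodes → τ′ ⊑ τ → (root ++ τ′) ∈ Nodes

  -- Membership proofs are irrelevant, so a node is determined by its word
  -- and a function on nodes cannot depend on the proof.
  Node : Set
  Node = Refinement Word Nodes

  Child : Node → Pred Node 0ℓ
  Child x y = ∃[ i ] value y ≡ value x ∷ʳ i

  Descendant : Node → Pred Node 0ℓ
  Descendant x y = value x ⊑ value y

Finite : {A : Set} → Pred A 0ℓ → Set
Finite {A} X = ∃[ xs ] (∀ (a : A) → a ∈ X → a ∈ˡ xs)

NonBlocking : Tree → Set
NonBlocking T = ∀ (x : Node) → ∃[ y ] Child x y
  where open Tree T

-- The finite set of atomic propositions is Fin k.
record KripkeTree (k : ℕ) : Set₁ where
  field
    tree        : Tree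
    nonBlocking : NonBlocking tree
    Lab         : Tree.Node tree → Subset k

  open Tree tree public

FinitelyBranching : KripkeTree k → Set
FinitelyBranching K = ∀ (x : Node) → Finite (Child x)
  where open KripkeTree K

-- Formulas over Fin k with free variables among m first-order and
-- n second-order ones (de Bruijn indices, innermost binder first).
infix  8 _≤ᶠ_ _∈ᶠ_
infix  7 ¬ᶠ_
infixr 6 _∧ᶠ_

data Formula (k : ℕ) : (m n : ℕ) → Set where
  P    : Fin k → Fin m → Formula k m n
  _≤ᶠ_ : Fin m → Fin m → Formula k m n
  _∈ᶠ_ : Fin m → Fin n → Formula k m n
  ¬ᶠ_  : Formula k m n → Formula k m n
  _∧ᶠ_ : Formula k m n → Formula k m n → Formula k m n
  ∃¹_  : Formula k (ℕ.suc m) n → Formula k m n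
  ∃²_  : Formula k m (ℕ.suc n) → Formula k m n

Sentence : ℕ → Set
Sentence k = Formula k 0 0

-- The logics share their syntax and differ in the range of ∃².
data Logic : Set where
  MSO WMSO coWMSO : Logic

InRange : Logic → {A : Set} → Pred (Pred A 0ℓ) 0ℓ
InRange MSO    X = ⊤
InRange WMSO   X = Finite X
InRange coWMSO X = ¬ Finite X

module Semantics (L : Logic) (K : KripkeTree k) where
  open KripkeTree K

  Sat : Vec Node m → Vec (Pred Node 0ℓ) n → Formula k m n → Set₁
  Sat ν μ (P a x)  = Lift (lsuc 0ℓ) (a ∈ˢ Lab (lookup ν x))
  Sat ν μ (x ≤ᶠ y) = Lift (lsuc 0ℓ) (Descendant (lookup ν x) (lookup ν y))
  Sat ν μ (x ∈ᶠ X) = Lift (lsuc 0ℓ) (lookup ν x ∈ lookup μ X)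
  Sat ν μ (¬ᶠ φ)   = ¬ Sat ν μ φ
  Sat ν μ (φ ∧ᶠ ψ) = Sat ν μ φ × Sat ν μ ψ
  Sat ν μ (∃¹ φ)   = Σ[ x ∈ Node ] Sat (x ∷ ν) μ φ
  Sat ν μ (∃² φ)   = Σ[ X ∈ Pred Node 0ℓ ] (InRange L X × Sat ν (X ∷ μ) φ)

infix 4 _⊨[_]_

_⊨[_]_ : KripkeTree k → Logic → Sentence k → Set₁
K ⊨[ L ] φ = Semantics.Sat L K [] [] φ

Class : Set₁
Class = ∀ (k : ℕ) → Pred (KripkeTree k) 0ℓ

AllKripkeTrees : Class
AllKripkeTrees k = U

FinitelyBranchingKripkeTrees : Class
FinitelyBranchingKripkeTrees k = FinitelyBranching

Equivalent : Class → Logic → Sentence k → Logic → Sentence k → Set₁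
Equivalent {k} C L φ L′ ψ =
  ∀ (K : KripkeTree k) → K ∈ C k → (K ⊨[ L ] φ) ⇔ (K ⊨[ L′ ] ψ)

infix 4 _≤[_]_ _≡[_]_ _<[_]_

_≤[_]_ : Logic → Class → Logic → Set₁
L ≤[ C ] L′ = ∀ (k : ℕ) (φ : Sentence k) → ∃[ ψ ] Equivalent C L φ L′ ψ

_≡[_]_ : Logic → Class → Logic → Set₁
L ≡[ C ] L′ = (L ≤[ C ] L′) × (L′ ≤[ C ] L)

_<[_]_ : Logic → Class → Logic → Set₁
L <[ C ] L′ = (L ≤[ C ] L′) × ¬ (L′ ≤[ C ] L)

{-# OPTIONS --safe #-}
-- In coWMSO, an arbitrary set can be quantified as an infinite set or the
-- complement of one, and a finite set as the complement of an infinite set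
-- that meets every infinite set; over finitely branching trees, MSO expresses
-- infinity by König's lemma.
--
-- MSO cannot express infinite branching. In a tree made of a root and disjoint
-- ω-chains, an Ehrenfeucht–Fraïssé argument shows that MSO sees only, up to a
-- threshold, how many chains realise each of finitely many types, so it does
-- not distinguish infinitely many chains from a large finite number.
--
-- WMSO cannot express "some infinite chain of nodes is labelled p", even on
-- the binary tree. Second-order quantifiers of WMSO range over a countable set,
-- so every WMSO-definable set of labellings is analytic, and so is its
-- complement: it consists of the labellings L such that some sequence α
-- satisfies closed conditions on (α, L). Given a sentence φ expressing
-- the property, label the code of a finite sequence s with p iff the conditions
-- for ¬φ have not failed along s. The new labels depend only on the old labels
-- closer to the root, so some labelling is its own image, and it satisfies φ
-- iff it satisfies ¬φ.
module Submission where

open import Defs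
open import Axiom.ExcludedMiddle using (ExcludedMiddle)
open import Data.Bool using (Bool; true; false; if_then_else_)
open import Data.Empty using (⊥; ⊥-elim)
open import Data.Fin using (Fin; zero; suc; toℕ; remQuot; combine; inject≤)
open import Data.Fin.Properties using (remQuot-combine; inject≤-injective; toℕ-injective) renaming (suc-injective to Fin-suc-injective)
open import Data.Fin.Subset using (Subset) renaming (_∈_ to _∈ˢ_)
open import Data.Irrelevant using ([_])
open import Data.List as List using (List; []; _∷_; _++_; _∷ʳ_; length; filter; applyUpTo; replicate; allFin)
open import Data.List.Properties using (length-++; ++-assoc; ++-identityʳ; length-applyUpTo; length-replicate; ∷-injective)
open import Data.List.Membership.Propositional using (lose) renaming (_∈_ to _∈ˡ_)
open import Data.List.Membership.Propositional.Properties using (∈-++⁺ˡ; ∈-++⁺ʳ; ∈-concatMap⁺; ∈-filter⁺; ∈-filter⁻; ∈-map⁺; ∈-allFin)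
open import Data.List.Relation.Unary.All as All using (All; []; _∷_; all?)
open import Data.List.Relation.Unary.All.Properties as All using ()
open import Data.List.Relation.Unary.Any using (here; there)
open import Data.Maybe using (Maybe; just; nothing)
open import Data.Maybe.Properties using (just-injective)
open import Data.Nat using (ℕ; zero; suc; _+_; _*_; _^_; _≤_; _<_; _⊔_; z≤n; s≤s)
open import Data.Nat.Properties hiding (suc-injective)
open import Data.Product using (Σ-syntax; ∃-syntax; _×_; _,_; proj₁; proj₂)
open import Data.Product.Properties using (,-injective)
open import Data.Refinement using (value; value-injective) renaming (_,_ to _,ᴿ_)
open import Data.Sum as Sum using (_⊎_; inj₁; inj₂; [_,_]′)
open import Data.Unit using (⊤; tt)
open import Data.Vec as Vec using (Vec; []; _∷_; lookup; tabulate)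
open import Data.Vec.Properties using ([]=⇒lookup; lookup⇒[]=; ++-injective; lookup∘tabulate; lookup-map; tabulate-cong; ∷-injectiveʳ; ∷-injectiveˡ)
open import Function using (_∘_; id; case_of_; _⇔_; mk⇔)
open import Function.Bundles using (Equivalence)
open import Level using (Level; Lift; lift; lower; 0ℓ) renaming (suc to lsuc; _⊔_ to _⊔ˡ_)
open import Relation.Binary.PropositionalEquality using (_≡_; _≢_; refl; sym; trans; cong; cong₂; subst; subst₂)
open import Relation.Nullary using (¬_; Dec; yes; no; does; contradiction; recompute)
open import Relation.Nullary.Decidable using (decidable-stable; dec-true; does-⇔)
open import Relation.Unary using (Pred; _∈_; U; ∁; _∩_)
open Equivalence using (to; from)

private
  variable
    ℓ ℓ′ : Level
    A B I J : Set
    k m n s t t₁ t₂ : ℕ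

-- Equivalences under lifting and negation

lift⇔ : {Q R : Set} → Q ⇔ R → Lift (lsuc 0ℓ) Q ⇔ Lift (lsuc 0ℓ) R
lift⇔ e = mk⇔ (λ q → lift (to e (lower q))) (λ r → lift (from e (lower r)))

¬⇔ : {Q : Set ℓ} {R : Set ℓ′} → Q ⇔ R → (¬ Q) ⇔ (¬ R)
¬⇔ e = mk⇔ (λ ¬q r → ¬q (from e r)) (λ ¬r q → ¬r (to e q))

-- Finite sets

finite-⊆ : {X Y : Pred A 0ℓ} → (∀ x → x ∈ X → x ∈ Y) → Finite Y → Finite X
finite-⊆ X⊆Y (xs , covers) = xs , λ x x∈X → covers x (X⊆Y x x∈X)

finite-∪ : {X Y Z : Pred A 0ℓ} → (∀ x → x ∈ Z → x ∈ X ⊎ x ∈ Y) → Finite X → Finite Y → Finite Z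
finite-∪ split (xs , cx) (ys , cy) =
  xs ++ ys , λ z z∈Z → [ ∈-++⁺ˡ ∘ cx z , ∈-++⁺ʳ xs ∘ cy z ]′ (split z z∈Z)

list-bounded : (f : A → ℕ) (xs : List A) → ∃[ b ] (∀ x → x ∈ˡ xs → f x ≤ b)
list-bounded f [] = 0 , λ _ ()
list-bounded f (x ∷ xs) with list-bounded f xs
... | b , bound = f x ⊔ b , λ where
  _ (here refl)  → m≤m⊔n (f x) b
  y (there y∈xs) → ≤-trans (bound y y∈xs) (m≤n⊔m (f x) b)

unbounded⇒¬finite : (f : A → ℕ) {X : Pred A 0ℓ} → (∀ b → ∃[ x ] (x ∈ X × b ≤ f x)) → ¬ Finite X
unbounded⇒¬finite f {X} big (xs , covers) with list-bounded f xs
... | b , bound with big (suc b)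
... | x , x∈X , b<fx = <⇒≱ b<fx (bound x (covers x x∈X))

-- Words

∷ʳ-⊑ : ∀ {σ τ : Word} → σ ⊑ τ → σ ≡ τ ⊎ ∃[ i ] (σ ∷ʳ i) ⊑ τ
∷ʳ-⊑ {σ} ([] , refl)    = inj₁ (sym (++-identityʳ σ))
∷ʳ-⊑ {σ} (i ∷ ρ , refl) = inj₂ (i , ρ , sym (++-assoc σ (i ∷ []) ρ))

⊑-refl : ∀ {σ : Word} → σ ⊑ σ
⊑-refl {σ} = [] , sym (++-identityʳ σ)

⊑-length : ∀ {σ τ : Word} → σ ⊑ τ → length σ ≤ length τ
⊑-length {σ} (ρ , refl) = subst (length σ ≤_) (sym (length-++ σ)) (m≤m+n (length σ) (length ρ))

⊑∧⋢⇒length< : ∀ {σ τ : Word} → σ ⊑ τ → ¬ τ ⊑ σ → length σ < length τ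
⊑∧⋢⇒length< {σ} σ⊑τ τ⋢σ with ∷ʳ-⊑ σ⊑τ
... | inj₁ refl = contradiction ⊑-refl τ⋢σ
... | inj₂ (i , σi⊑τ) = ≤-trans (≤-reflexive (sym (trans (length-++ σ) (+-comm (length σ) 1)))) (⊑-length σi⊑τ)

∷-⊑ : ∀ {σ τ : Word} a → σ ⊑ τ → (a ∷ σ) ⊑ (a ∷ τ)
∷-⊑ a (ρ , refl) = ρ , refl

++-⊑ : ∀ {σ τ : Word} υ → σ ⊑ τ → (υ ++ σ) ⊑ (υ ++ τ)
++-⊑ []      p = p
++-⊑ (a ∷ υ) p = ∷-⊑ a (++-⊑ υ p)

-- Pairing and countability

-- Cantor's walk: one step along the current antidiagonal, or from its end to the start of the
-- following one.
next : ℕ × ℕ → ℕ × ℕ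
next (zero  , j) = suc j , zero
next (suc i , j) = i , suc j

unpair : ℕ → ℕ × ℕ
unpair zero    = zero , zero
unpair (suc n) = next (unpair n)

unpair-diagonal : ∀ i j → ∃[ n ] unpair n ≡ (i + j , zero) → ∃[ n ] unpair n ≡ (i , j)
unpair-diagonal i zero (n , eq) = n , trans eq (cong (_, zero) (+-identityʳ i))
unpair-diagonal i (suc j) (n , eq) with unpair-diagonal (suc i) j (n , trans eq (cong (_, zero) (+-suc i j)))
... | n′ , eq′ = suc n′ , cong next eq′

unpair-axis : ∀ s → ∃[ n ] unpair n ≡ (s , zero)
unpair-axis zero = zero , refl
unpair-axis (suc s) with unpair-diagonal zero s (unpair-axis s)
... | n , eq = suc n , cong next eq

unpair-surjective : ∀ i j → ∃[ n ] unpair n ≡ (i , j)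
unpair-surjective i j = unpair-diagonal i j (unpair-axis (i + j))

pair : ℕ → ℕ → ℕ
pair i j = proj₁ (unpair-surjective i j)

unpair-pair : ∀ i j → unpair (pair i j) ≡ (i , j)
unpair-pair i j = proj₂ (unpair-surjective i j)

Countable : Set → Set
Countable A = Σ[ e ∈ (ℕ → A) ] (∀ a → ∃[ i ] e i ≡ a)

-- A code pairs the length with the packed entries, so that decoding can recurse on the length.
countable-List : Countable A → Countable (List A)
countable-List {A} (e , e-onto) = (λ c → decode (proj₁ (unpair c)) (proj₂ (unpair c))) , λ xs →
  let c , eq = decode-onto xs
  in pair (length xs) c , trans (cong (λ p → decode (proj₁ p) (proj₂ p)) (unpair-pair (length xs) c)) eq
  where
  decode : ℕ → ℕ → List A
  decode zero    c = []
  decode (suc l) c = e (proj₁ (unpair c)) ∷ decode l (proj₂ (unpair c))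
  decode-onto : ∀ xs → ∃[ c ] decode (length xs) c ≡ xs
  decode-onto [] = zero , refl
  decode-onto (x ∷ xs) with e-onto x | decode-onto xs
  ... | i , refl | c , eq = pair i c , trans
    (cong (λ p → e (proj₁ p) ∷ decode (length xs) (proj₂ p)) (unpair-pair i c)) (cong (e i ∷_) eq)

-- Used for countable intersections, to choose a stage late enough to see the first `m` entries of
-- one component's witness.
bounded-below : (f : ℕ → ℕ) (m : ℕ) → ∃[ n ] (m ≤ n × ∀ j → j < m → f j < n)
bounded-below f zero = zero , z≤n , λ _ ()
bounded-below f (suc m) with bounded-below f m
... | n , m≤n , bound = suc n ⊔ suc (f m) , ≤-trans (s≤s m≤n) (m≤m⊔n (suc n) (suc (f m))) , bound′
  where
  bound′ : ∀ j → j < suc m → f j < suc n ⊔ suc (f m)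
  bound′ j (s≤s j≤m) with m≤n⇒m<n∨m≡n j≤m
  ... | inj₁ j<m  = <-≤-trans (bound j j<m) (≤-trans (n≤1+n n) (m≤m⊔n (suc n) (suc (f m))))
  ... | inj₂ refl = m≤n⊔m (suc n) (suc (f m))

-- Analytic sets of labellings

Sequence Labelling : Set
Sequence  = ℕ → ℕ
Labelling = Word → Bool

infix 4 _≈⟨_⟩_ _≋⟨_⟩_

_≈⟨_⟩_ : Sequence → ℕ → Sequence → Set
α ≈⟨ n ⟩ β = ∀ i → i < n → α i ≡ β i

_≋⟨_⟩_ : Labelling → ℕ → Labelling → Set
L ≋⟨ n ⟩ M = ∀ w → length w < n → L w ≡ M w

-- The set is the projection of a closed set of pairs `(α , L)`: by `local`, `Stage n` depends only
-- on the first `n` entries of `α` and the labels of words shorter than `n`.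
record Analytic (Q : Labelling → Set ℓ) : Set (lsuc 0ℓ ⊔ˡ ℓ) where
  field
    Stage  : ℕ → Sequence → Labelling → Set
    local  : ∀ {n α β L M} → α ≈⟨ n ⟩ β → L ≋⟨ n ⟩ M → Stage n α L → Stage n β M
    branch : ∀ L → Q L ⇔ (Σ[ α ∈ Sequence ] ∀ n → Stage n α L)

open Analytic

analytic-resp : {Q : Labelling → Set ℓ} {R : Labelling → Set ℓ′} →
                (∀ L → Q L ⇔ R L) → Analytic Q → Analytic R
analytic-resp e a .Stage    = a .Stage
analytic-resp e a .local    = a .local
analytic-resp e a .branch L = mk⇔ (to (a .branch L) ∘ from (e L)) (to (e L) ∘ from (a .branch L))

-- The condition is vacuous before stage `n`, when the labels that decide `Q` have become visible.
analytic-clopen : ∀ n {Q : Labelling → Set} → (∀ {L M} → L ≋⟨ n ⟩ M → Q L → Q M) → Analytic Q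
analytic-clopen n {Q} dep .Stage m α L = n ≤ m → Q L
analytic-clopen n dep .local L≈M α≈β s n≤m = dep (λ w w< → α≈β w (<-≤-trans w< n≤m)) (s n≤m)
analytic-clopen n dep .branch L = mk⇔ (λ q → (λ _ → zero) , λ _ _ → q) (λ (α , s) → s n ≤-refl)

-- The first entry of the witness names a member of the union and the remaining entries witness
-- membership in it, so stages are shifted by one.
analytic-⋃ : {Q : ℕ → Labelling → Set ℓ} → (∀ i → Analytic (Q i)) → Analytic (λ L → Σ[ i ∈ ℕ ] Q i L)
analytic-⋃ a .Stage zero    α L = ⊤
analytic-⋃ a .Stage (suc n) α L = a (α zero) .Stage n (α ∘ suc) L
analytic-⋃ a .local {zero} _ _ _ = tt
analytic-⋃ a .local {suc n} {α} {β} α≈β L≈M s rewrite sym (α≈β zero (s≤s z≤n)) =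
  a (α zero) .local (λ i i<n → α≈β (suc i) (s≤s i<n)) (λ w w<n → L≈M w (<-trans w<n (n<1+n n))) s
analytic-⋃ a .branch L = mk⇔
  (λ (i , q) → let α , s = to (a i .branch L) q
               in (λ { zero → i ; (suc j) → α j }) , λ { zero → tt ; (suc n) → s n })
  (λ (α , s) → α zero , from (a (α zero) .branch L) (α ∘ suc , s ∘ suc))

-- One sequence interleaves the witnesses for all `i`, the one for `i` sitting at the positions
-- `pair i j`. Stage `n` imposes only those component stages whose entries it can read, which keeps
-- it local.
analytic-⋂ : {Q : ℕ → Labelling → Set ℓ} → (∀ i → Analytic (Q i)) → Analytic (λ L → ∀ i → Q i L)
analytic-⋂ a .Stage n α L =
  ∀ i m → m ≤ n → (∀ j → j < m → pair i j < n) → a i .Stage m (α ∘ pair i) L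
analytic-⋂ a .local α≈β L≈M s i m m≤n small = a i .local
  (λ j j<m → α≈β (pair i j) (small j j<m)) (λ w w<m → L≈M w (<-≤-trans w<m m≤n)) (s i m m≤n small)
analytic-⋂ a .branch L = mk⇔
  (λ q → let α = λ c → proj₁ (to (a (proj₁ (unpair c)) .branch L) (q (proj₁ (unpair c)))) (proj₂ (unpair c))
         in α , λ n i m _ _ → a i .local
              (λ j _ → sym (cong (λ p → proj₁ (to (a (proj₁ p) .branch L) (q (proj₁ p))) (proj₂ p)) (unpair-pair i j)))
              (λ _ _ → refl) (proj₂ (to (a i .branch L) (q i)) m))
  (λ (α , s) i → from (a i .branch L) (α ∘ pair i , λ m →
     let n , m≤n , small = bounded-below (pair i) m in s n i m m≤n small))

analytic-∃ : Countable A → {Q : A → Labelling → Set ℓ} →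
             (∀ x → Analytic (Q x)) → Analytic (λ L → Σ[ x ∈ A ] Q x L)
analytic-∃ (e , onto) {Q} a = analytic-resp
  (λ L → mk⇔ (λ (i , q) → e i , q)
             (λ (x , q) → proj₁ (onto x) , subst (λ y → Q y L) (sym (proj₂ (onto x))) q))
  (analytic-⋃ (a ∘ e))

analytic-∀ : Countable A → {Q : A → Labelling → Set ℓ} →
             (∀ x → Analytic (Q x)) → Analytic (λ L → ∀ x → Q x L)
analytic-∀ (e , onto) {Q} a = analytic-resp
  (λ L → mk⇔ (λ q x → subst (λ y → Q y L) (proj₂ (onto x)) (q (proj₁ (onto x)))) (_∘ e))
  (analytic-⋂ (a ∘ e))

countable-Bool : Countable Bool
countable-Bool = (λ { zero → true ; (suc _) → false }) , λ { true → zero , refl ; false → suc zero , refl }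

analytic-⊎ : {Q R : Labelling → Set ℓ} → Analytic Q → Analytic R → Analytic (λ L → Q L ⊎ R L)
analytic-⊎ {Q = Q} {R} a b = analytic-resp
  (λ L → mk⇔ (λ { (true , q) → inj₁ q ; (false , r) → inj₂ r })
             (λ { (inj₁ q) → true , q ; (inj₂ r) → false , r }))
  (analytic-∃ countable-Bool {λ { true → Q ; false → R }} λ { true → a ; false → b })

analytic-× : {Q R : Labelling → Set ℓ} → Analytic Q → Analytic R → Analytic (λ L → Q L × R L)
analytic-× {Q = Q} {R} a b = analytic-resp
  (λ L → mk⇔ (λ q → q true , q false) (λ { (q , r) true → q ; (q , r) false → r }))
  (analytic-∀ countable-Bool {λ { true → Q ; false → R }} λ { true → a ; false → b })

-- Binary codes of sequences

Binary : Pred Word 0ℓ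
Binary = All (_≤ 1)

-- Each entry `a` becomes a block of `a` ones closed by a zero. This embeds the infinitely branching
-- tree of finite sequences into the binary tree and preserves and reflects the prefix order.
code : List ℕ → Word
code []      = []
code (a ∷ s) = replicate a 1 ++ 0 ∷ code s

code-binary : ∀ s → Binary (code s)
code-binary []      = []
code-binary (a ∷ s) = All.++⁺ (All.replicate⁺ a ≤-refl) (z≤n ∷ code-binary s)

-- Each block has at least its closing zero. Hence the stages up to `length s` depend only on labels
-- of words shorter than `code s`.
length-code : ∀ s → length s ≤ length (code s)
length-code []      = z≤n
length-code (a ∷ s) = begin
  suc (length s)                                     ≤⟨ s≤s (length-code s) ⟩
  suc (length (code s))                              ≤⟨ m≤n+m _ (length (replicate a 1)) ⟩
  length (replicate a 1) + suc (length (code s))     ≡⟨ length-++ (replicate a 1) ⟨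
  length (code (a ∷ s))                              ∎
  where open ≤-Reasoning

code-mono : ∀ {s t} → s ⊑ t → code s ⊑ code t
code-mono {[]}    {t} _ = code t , refl
code-mono {a ∷ s} (ρ , refl) = ++-⊑ (replicate a 1) (∷-⊑ 0 (code-mono {s} (ρ , refl)))

-- The first zero marks where the block ends.
block-injective : ∀ a b {σ τ : Word} → replicate a 1 ++ 0 ∷ σ ≡ replicate b 1 ++ 0 ∷ τ → a ≡ b × σ ≡ τ
block-injective zero    zero    eq = refl , proj₂ (∷-injective eq)
block-injective (suc a) (suc b) eq with block-injective a b (proj₂ (∷-injective eq))
... | refl , eq′ = refl , eq′

code-reflects : ∀ s t → code s ⊑ code t → s ⊑ t
code-reflects []      t       _        = t , refl
code-reflects (a ∷ s) []      (ρ , eq) with replicate a 1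
code-reflects (a ∷ s) []      (ρ , ()) | []
code-reflects (a ∷ s) []      (ρ , ()) | _ ∷ _
code-reflects (a ∷ s) (b ∷ t) (ρ , eq)
  with block-injective b a (trans eq (++-assoc (replicate a 1) (0 ∷ code s) ρ))
... | refl , eq′ = ∷-⊑ b (code-reflects s t (ρ , eq′))

-- Zero is an arbitrary default past the end of the list; stages up to `length s` do not depend on
-- it.
entry : List ℕ → Sequence
entry []      _       = zero
entry (a ∷ s) zero    = a
entry (a ∷ s) (suc i) = entry s i

entry-⊑ : ∀ {s t} → s ⊑ t → entry s ≈⟨ length s ⟩ entry t
entry-⊑ {[]}    _          i       ()
entry-⊑ {a ∷ s} (ρ , refl) zero    _        = refl
entry-⊑ {a ∷ s} (ρ , refl) (suc i) (s≤s i<) = entry-⊑ {s} (ρ , refl) i i<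

entry-applyUpTo : ∀ α n → entry (applyUpTo α n) ≈⟨ n ⟩ α
entry-applyUpTo α (suc n) zero    _         = refl
entry-applyUpTo α (suc n) (suc i) (s≤s i<n) = entry-applyUpTo (α ∘ suc) n i i<n

applyUpTo-⊑ : ∀ (α : Sequence) {m n} → m ≤ n → applyUpTo α m ⊑ applyUpTo α n
applyUpTo-⊑ α {zero}  {n}     _         = applyUpTo α n , refl
applyUpTo-⊑ α {suc m} {suc n} (s≤s m≤n) = ∷-⊑ (α zero) (applyUpTo-⊑ (α ∘ suc) m≤n)

prefixes : Word → List Word
prefixes []      = [] ∷ []
prefixes (a ∷ w) = [] ∷ List.map (a ∷_) (prefixes w)

⊑⇒∈prefixes : ∀ {σ τ} → σ ⊑ τ → σ ∈ˡ prefixes τ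
⊑⇒∈prefixes {[]}    {[]}    _          = here refl
⊑⇒∈prefixes {[]}    {a ∷ τ} _          = here refl
⊑⇒∈prefixes {a ∷ σ} {_}     (ρ , refl) = there (∈-map⁺ (a ∷_) (⊑⇒∈prefixes (ρ , refl)))

-- Derived connectives

infixr 5 _∨ᶠ_
infixr 4 _⇒ᶠ_
infix  3 ∀¹_

_∨ᶠ_ _⇒ᶠ_ : Formula k m n → Formula k m n → Formula k m n
φ ∨ᶠ ψ = ¬ᶠ (¬ᶠ φ ∧ᶠ ¬ᶠ ψ)
φ ⇒ᶠ ψ = ¬ᶠ (φ ∧ᶠ ¬ᶠ ψ)

∀¹_ : Formula k (suc m) n → Formula k m n
∀¹ φ = ¬ᶠ (∃¹ (¬ᶠ φ))

-- Sets are predicates, which may have the same elements without being identical. This allows a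
-- finite set to be replaced by membership in a list.
sat-ext : ∀ (L : Logic) (K : KripkeTree k) (let open KripkeTree K; open Semantics L K) →
          (ν : Vec Node m) (μ μ′ : Vec (Pred Node 0ℓ) n) (φ : Formula k m n) →
          (∀ X x → x ∈ lookup μ X ⇔ x ∈ lookup μ′ X) → Sat ν μ φ ⇔ Sat ν μ′ φ
sat-ext L K ν μ μ′ (P a x)  e = mk⇔ id id
sat-ext L K ν μ μ′ (x ≤ᶠ y) e = mk⇔ id id
sat-ext L K ν μ μ′ (x ∈ᶠ X) e = lift⇔ (e X (lookup ν x))
sat-ext L K ν μ μ′ (¬ᶠ φ)   e = ¬⇔ (sat-ext L K ν μ μ′ φ e)
sat-ext L K ν μ μ′ (φ ∧ᶠ ψ) e =
  mk⇔ (λ (s , t) → to (sat-ext L K ν μ μ′ φ e) s , to (sat-ext L K ν μ μ′ ψ e) t)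
      (λ (s , t) → from (sat-ext L K ν μ μ′ φ e) s , from (sat-ext L K ν μ μ′ ψ e) t)
sat-ext L K ν μ μ′ (∃¹ φ) e =
  mk⇔ (λ (x , s) → x , to (sat-ext L K (x ∷ ν) μ μ′ φ e) s)
      (λ (x , s) → x , from (sat-ext L K (x ∷ ν) μ μ′ φ e) s)
sat-ext L K ν μ μ′ (∃² φ) e = mk⇔
  (λ (X , r , s) → X , r , to (sat-ext L K ν (X ∷ μ) (X ∷ μ′) φ (e′ X)) s)
  (λ (X , r , s) → X , r , from (sat-ext L K ν (X ∷ μ) (X ∷ μ′) φ (e′ X)) s)
  where
  e′ : ∀ X Y x → x ∈ lookup (X ∷ μ) Y ⇔ x ∈ lookup (X ∷ μ′) Y
  e′ X zero    x = mk⇔ id id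
  e′ X (suc Y) x = e Y x

-- Arguments under excluded middle

module Classical (em : ∀ ℓ → ExcludedMiddle ℓ) where

  does-true : {Q : Set} (d : Dec Q) → does d ≡ true → Q
  does-true (yes q) _ = q

  stable : {Q : Set ℓ} → ¬ ¬ Q → Q
  stable = decidable-stable (em _)

  ¬finite⇒inhabited : {X : Pred A 0ℓ} → ¬ Finite X → ∃[ x ] x ∈ X
  ¬finite⇒inhabited ¬fin = stable λ none → ¬fin ([] , λ x x∈X → ⊥-elim (none (x , x∈X)))

  module Trees (K : KripkeTree k) where
    open KripkeTree K

    depth : Node → ℕ
    depth x = length (value x)

    -- Non-blocking lets a path be prolonged forever, so every Kripke tree is infinite, and so are
    -- complements of finite sets of nodes.
    deep : ∀ b → ∃[ x ] (x ∈ U {A = Node} × b ≤ depth x)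
    deep zero = (root ,ᴿ [ root∈ ]) , tt , z≤n
    deep (suc b) with deep b
    ... | x , _ , b≤ with nonBlocking x
    ... | y , i , y≡ = y , tt , (begin
      suc b                     ≤⟨ s≤s b≤ ⟩
      suc (depth x)             ≡⟨ +-comm 1 (depth x) ⟩
      depth x + 1               ≡⟨ length-++ (value x) ⟨
      length (value x ∷ʳ i)     ≡⟨ cong length y≡ ⟨
      depth y                   ∎)
      where open ≤-Reasoning

    finite⇒∁-infinite : {X : Pred Node 0ℓ} → Finite X → ¬ Finite (∁ X)
    finite⇒∁-infinite {X} finX fin∁ =
      unbounded⇒¬finite depth deep (finite-∪ split finX fin∁)
      where
      split : ∀ x → x ∈ U → x ∈ X ⊎ x ∈ ∁ X
      split x _ with em _ {x ∈ X}
      ... | yes x∈X = inj₁ x∈X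
      ... | no  x∉X = inj₂ x∉X

  ∨-classical : {Q : Set ℓ} {R : Set ℓ′} → (¬ (¬ Q × ¬ R)) ⇔ (Q ⊎ R)
  ∨-classical = mk⇔
    (λ s → stable λ neither → s (neither ∘ inj₁ , neither ∘ inj₂))
    (λ s (¬q , ¬r) → [ ¬q , ¬r ]′ s)

  ⇒-classical : {Q : Set ℓ} {R : Set ℓ′} → (¬ (Q × ¬ R)) ⇔ (Q → R)
  ⇒-classical = mk⇔ (λ s q → stable λ ¬r → s (q , ¬r)) (λ f (q , ¬r) → ¬r (f q))

  ∀-classical : {A : Set ℓ} {Q : A → Set ℓ′} → (¬ (Σ[ x ∈ A ] ¬ Q x)) ⇔ (∀ x → Q x)
  ∀-classical = mk⇔ (λ s x → stable λ ¬q → s (x , ¬q)) (λ f (x , ¬q) → ¬q (f x))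

  -- MSO in coWMSO: one of a set and its complement is infinite, so a set is
  -- represented by an infinite set and a sign.

  signed : Vec Bool n → Formula k m n → Formula k m n
  signed bs (P a x)  = P a x
  signed bs (x ≤ᶠ y) = x ≤ᶠ y
  signed bs (x ∈ᶠ X) = if lookup bs X then x ∈ᶠ X else ¬ᶠ (x ∈ᶠ X)
  signed bs (¬ᶠ φ)   = ¬ᶠ (signed bs φ)
  signed bs (φ ∧ᶠ ψ) = signed bs φ ∧ᶠ signed bs ψ
  signed bs (∃¹ φ)   = ∃¹ (signed bs φ)
  signed bs (∃² φ)   = ∃² (signed (true ∷ bs) φ ∨ᶠ signed (false ∷ bs) φ)

  module SignedSemantics (K : KripkeTree k) where
    open KripkeTree K
    open Trees K
    module M = Semantics MSO K
    open Semantics coWMSO K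

    withSign : Bool → Pred Node 0ℓ → Pred Node 0ℓ
    withSign true  X = X
    withSign false X = ∁ X

    Represents : Vec Bool n → (μ μ′ : Vec (Pred Node 0ℓ) n) → Set
    Represents bs μ μ′ = ∀ X x → x ∈ lookup μ X ⇔ x ∈ withSign (lookup bs X) (lookup μ′ X)

    extend : ∀ {bs} {μ μ′ : Vec (Pred Node 0ℓ) n} b {X Y} → Represents bs μ μ′ →
             (∀ x → x ∈ X ⇔ x ∈ withSign b Y) → Represents (b ∷ bs) (X ∷ μ) (Y ∷ μ′)
    extend b r e zero    = e
    extend b r e (suc X) = r X

    sat-signed : ∀ bs {ν : Vec Node m} {μ μ′ : Vec (Pred Node 0ℓ) n} (φ : Formula k m n) →
                 Represents bs μ μ′ → M.Sat ν μ φ ⇔ Sat ν μ′ (signed bs φ)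
    sat-signed bs (P a x)  r = mk⇔ id id
    sat-signed bs (x ≤ᶠ y) r = mk⇔ id id
    sat-signed bs {ν} (x ∈ᶠ X) r with lookup bs X | r X (lookup ν x)
    ... | true  | e = lift⇔ e
    ... | false | e = mk⇔ (λ s t → to e (lower s) (lower t)) (λ s → lift (from e (s ∘ lift)))
    sat-signed bs (¬ᶠ φ)   r = ¬⇔ (sat-signed bs φ r)
    sat-signed bs (φ ∧ᶠ ψ) r =
      mk⇔ (λ (s , t) → to (sat-signed bs φ r) s , to (sat-signed bs ψ r) t)
          (λ (s , t) → from (sat-signed bs φ r) s , from (sat-signed bs ψ r) t)
    sat-signed bs (∃¹ φ)   r =
      mk⇔ (λ (x , s) → x , to (sat-signed bs φ r) s) (λ (x , s) → x , from (sat-signed bs φ r) s)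
    sat-signed bs {ν} {μ} {μ′} (∃² φ) r = mk⇔ forth back
      where
      φ⁺ = signed (true ∷ bs) φ
      φ⁻ = signed (false ∷ bs) φ
      forth : M.Sat ν μ (∃² φ) → Sat ν μ′ (∃² (φ⁺ ∨ᶠ φ⁻))
      forth (X , _ , s) with em _ {Finite X}
      ... | no  inf = X , inf , from ∨-classical
              (inj₁ (to (sat-signed (true ∷ bs) φ (extend true r λ _ → mk⇔ id id)) s))
      ... | yes fin = ∁ X , finite⇒∁-infinite fin , from ∨-classical
              (inj₂ (to (sat-signed (false ∷ bs) φ (extend false r λ _ → mk⇔ (λ p ¬p → ¬p p) stable)) s))
      back : Sat ν μ′ (∃² (φ⁺ ∨ᶠ φ⁻)) → M.Sat ν μ (∃² φ)
      back (Y , _ , s) with to ∨-classical s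
      ... | inj₁ t = Y , tt , from (sat-signed (true ∷ bs) φ (extend true r λ _ → mk⇔ id id)) t
      ... | inj₂ t = ∁ Y , tt , from (sat-signed (false ∷ bs) φ (extend false r λ _ → mk⇔ id id)) t

  MSO≤coWMSO : MSO ≤[ AllKripkeTrees ] coWMSO
  MSO≤coWMSO k φ = signed [] φ , λ K _ → SignedSemantics.sat-signed K [] φ λ ()

  -- WMSO in coWMSO: a finite set is represented by its complement.

  cofinite : Formula k m (suc n)
  cofinite = ¬ᶠ (∃² (∀¹ (zero ∈ᶠ zero ⇒ᶠ ¬ᶠ (zero ∈ᶠ suc zero))))

  complemented : Formula k m n → Formula k m n
  complemented (P a x)  = P a x
  complemented (x ≤ᶠ y) = x ≤ᶠ y
  complemented (x ∈ᶠ X) = ¬ᶠ (x ∈ᶠ X)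
  complemented (¬ᶠ φ)   = ¬ᶠ (complemented φ)
  complemented (φ ∧ᶠ ψ) = complemented φ ∧ᶠ complemented ψ
  complemented (∃¹ φ)   = ∃¹ (complemented φ)
  complemented (∃² φ)   = ∃² (cofinite ∧ᶠ complemented φ)

  module ComplementedSemantics (K : KripkeTree k) where
    open KripkeTree K
    open Trees K
    module W = Semantics WMSO K
    open Semantics coWMSO K

    sat-cofinite : {ν : Vec Node m} {μ : Vec (Pred Node 0ℓ) n} {Y : Pred Node 0ℓ} →
                   Sat ν (Y ∷ μ) cofinite ⇔ Finite (∁ Y)
    sat-cofinite {ν = ν} {μ} {Y} = mk⇔ forth back
      where
      forth : Sat ν (Y ∷ μ) cofinite → Finite (∁ Y)
      -- If the complement of `Y` were infinite, it would itself be the infinite set disjoint from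
      -- `Y` that `cofinite` forbids.
      forth s = stable λ inf → s (∁ Y , inf , from ∀-classical
        λ x → from ⇒-classical λ x∉Y x∈Y → lower x∉Y (lower x∈Y))
      back : Finite (∁ Y) → Sat ν (Y ∷ μ) cofinite
      back fin (Z , inf , s) = inf (finite-⊆
        (λ x x∈Z x∈Y → to ⇒-classical (to ∀-classical s x) (lift x∈Z) (lift x∈Y)) fin)

    sat-complemented : {ν : Vec Node m} {μ μ′ : Vec (Pred Node 0ℓ) n} (φ : Formula k m n) →
                       (∀ X x → x ∈ lookup μ X ⇔ x ∈ ∁ (lookup μ′ X)) →
                       W.Sat ν μ φ ⇔ Sat ν μ′ (complemented φ)

    sat-complemented (P a x)  r = mk⇔ id id
    sat-complemented (x ≤ᶠ y) r = mk⇔ id id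
    sat-complemented {ν = ν} (x ∈ᶠ X) r =
      mk⇔ (λ s t → to e (lower s) (lower t)) (λ s → lift (from e (s ∘ lift)))
      where e = r X (lookup ν x)
    sat-complemented (¬ᶠ φ)   r = ¬⇔ (sat-complemented φ r)
    sat-complemented (φ ∧ᶠ ψ) r =
      mk⇔ (λ (s , t) → to (sat-complemented φ r) s , to (sat-complemented ψ r) t)
          (λ (s , t) → from (sat-complemented φ r) s , from (sat-complemented ψ r) t)
    sat-complemented (∃¹ φ)   r =
      mk⇔ (λ (x , s) → x , to (sat-complemented φ r) s) (λ (x , s) → x , from (sat-complemented φ r) s)
    sat-complemented {ν = ν} {μ′ = μ′} (∃² φ) r = mk⇔
      (λ (X , fin , s) → ∁ X , finite⇒∁-infinite fin ,
         from (sat-cofinite {ν = ν} {μ = μ′}) (finite-⊆ (λ _ → stable) fin) ,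
         to (sat-complemented φ λ { zero _ → mk⇔ (λ p ¬p → ¬p p) stable ; (suc X) → r X }) s)
      (λ (Y , _ , c , s) → ∁ Y , to (sat-cofinite {ν = ν} {μ = μ′}) c ,
         from (sat-complemented φ λ { zero _ → mk⇔ id id ; (suc X) → r X }) s)

  WMSO≤coWMSO : WMSO ≤[ AllKripkeTrees ] coWMSO
  WMSO≤coWMSO k φ = complemented φ , λ K _ → ComplementedSemantics.sat-complemented K φ λ ()

  -- coWMSO in MSO: by König's lemma, X is infinite iff some nonempty Y without
  -- maximal elements has an element of X below each of its elements.

  infinite : Formula k m (suc n)
  infinite = ∃² ((∃¹ (zero ∈ᶠ zero)) ∧ᶠ
                 (∀¹ (zero ∈ᶠ zero ⇒ᶠ
                   (∃¹ (zero ∈ᶠ zero ∧ᶠ suc zero ≤ᶠ zero ∧ᶠ ¬ᶠ (zero ≤ᶠ suc zero))) ∧ᶠ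
                   (∃¹ (zero ∈ᶠ suc zero ∧ᶠ suc zero ≤ᶠ zero)))))

  relativized : Formula k m n → Formula k m n
  relativized (P a x)  = P a x
  relativized (x ≤ᶠ y) = x ≤ᶠ y
  relativized (x ∈ᶠ X) = x ∈ᶠ X
  relativized (¬ᶠ φ)   = ¬ᶠ (relativized φ)
  relativized (φ ∧ᶠ ψ) = relativized φ ∧ᶠ relativized ψ
  relativized (∃¹ φ)   = ∃¹ (relativized φ)
  relativized (∃² φ)   = ∃² (infinite ∧ᶠ relativized φ)

  module König (K : KripkeTree k) where
    open KripkeTree K
    open Trees K

    below : Node → Pred Node 0ℓ → Pred Node 0ℓ
    below y X x = x ∈ X × Descendant y x

    -- The membership proof inside a node is irrelevant; excluded middle decides the prefix
    -- relation, so a proof of it can be recomputed.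
    root⊑ : ∀ (x : Node) → root ⊑ value x
    root⊑ (τ ,ᴿ [ τ∈ ]) = recompute (em _) (rooted τ τ∈)

    child-toward : ∀ (y x : Node) → Descendant y x → y ≡ x ⊎ ∃[ z ] (Child y z × Descendant z x)
    child-toward y x y⊑x with ∷ʳ-⊑ y⊑x
    ... | inj₁ y≡x = inj₁ (value-injective y≡x)
    ... | inj₂ (i , ρ , x≡) with root⊑ y
    child-toward (_ ,ᴿ _) (_ ,ᴿ [ x∈ ]) _ | inj₂ (i , ρ , refl) | υ , refl =
      -- `prefix-closed` concerns words split as `root ++ τ`, so the membership proof of `x` is
      -- rebracketed around `y` being `root ++ υ`.
      inj₂ (((root ++ υ) ∷ʳ i ,ᴿ [ subst Nodes (sym (++-assoc root υ (i ∷ [])))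
        (prefix-closed (υ ++ i ∷ ρ) (υ ∷ʳ i)
          (subst Nodes (trans (++-assoc (root ++ υ) (i ∷ []) ρ) (++-assoc root υ (i ∷ ρ))) x∈)
          (ρ , sym (++-assoc υ (i ∷ []) ρ))) ]) , (i , refl) , ρ , refl)

    -- Otherwise `y` and the finite lists belonging to its finitely many children would together
    -- cover all of `X` below `y`.
    infinite-child : FinitelyBranching K → ∀ {X} y → ¬ Finite (below y X) →
                     ∃[ z ] (Child y z × ¬ Finite (below z X))
    infinite-child fb {X} y inf = stable λ none → inf (gather none)
      where
      gather : ¬ (∃[ z ] (Child y z × ¬ Finite (below z X))) → Finite (below y X)
      gather none = y ∷ List.concatMap found (proj₁ (fb y)) , covers
        where
        found : Node → List Node
        found z with em _ {Finite (below z X)}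
        ... | yes (xs , _) = xs
        ... | no  _        = []
        found-covers : ∀ z x → Child y z → below z X x → x ∈ˡ found z
        found-covers z x ch x∈ with em _ {Finite (below z X)}
        ... | yes (xs , cov) = cov x x∈
        ... | no  inf        = contradiction (z , ch , inf) none
        covers : ∀ x → below y X x → x ∈ˡ y ∷ List.concatMap found (proj₁ (fb y))
        covers x (x∈X , y⊑x) with child-toward y x y⊑x
        ... | inj₁ refl = here refl
        ... | inj₂ (z , ch , z⊑x) = there (∈-concatMap⁺ found
                (lose (proj₂ (fb y) z ch) (found-covers z x ch (x∈X , z⊑x))))

    child-strict : ∀ {y z : Node} → Child y z → Descendant y z × ¬ Descendant z y
    child-strict {y} (i , refl) = (i ∷ [] , refl) , λ z⊑y → n≮n (length (value y))
      (subst (_≤ length (value y)) (trans (length-++ (value y)) (+-comm (length (value y)) 1)) (⊑-length z⊑y))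

  module RelativizedSemantics (K : KripkeTree k) (fb : FinitelyBranching K) where
    open KripkeTree K
    open Trees K
    open König K
    module C = Semantics coWMSO K
    open Semantics MSO K

    -- In the forward direction, passing repeatedly to strict descendants within `Y` reaches every
    -- depth, and an element of `X` below such a node is at least as deep.
    sat-infinite : (ν : Vec Node m) (μ : Vec (Pred Node 0ℓ) n) (X : Pred Node 0ℓ) →
                   Sat ν (X ∷ μ) infinite ⇔ (¬ Finite X)
    sat-infinite ν μ X = mk⇔ forth back
      where
      forth : Sat ν (X ∷ μ) infinite → ¬ Finite X
      forth (Y , _ , (y₀ , y₀∈Y) , s) = unbounded⇒¬finite depth λ b →
        let y , y∈Y , b≤y = climb b
            _ , x , x∈X , y⊑x = to ⇒-classical (to ∀-classical s y) (lift y∈Y)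
        in x , lower x∈X , ≤-trans b≤y (⊑-length (lower y⊑x))
        where
        climb : ∀ b → ∃[ y ] (y ∈ Y × b ≤ depth y)
        climb zero = y₀ , lower y₀∈Y , z≤n
        climb (suc b) =
          let y , y∈Y , b≤y = climb b
              (z , z∈Y , y⊑z , z⋢y) , _ = to ⇒-classical (to ∀-classical s y) (lift y∈Y)
          in z , lower z∈Y , ≤-trans (s≤s b≤y) (⊑∧⋢⇒length< (lower y⊑z) (z⋢y ∘ lift))
      back : ¬ Finite X → Sat ν (X ∷ μ) infinite
      -- `Y` collects the nodes with infinitely many descendants in `X`; each of them has a child of
      -- the same kind.
      back inf = (λ y → ¬ Finite (below y X)) , tt ,
        ((root ,ᴿ [ root∈ ]) , lift (λ fin → inf (finite-⊆ (λ x x∈X → x∈X , root⊑ x) fin))) ,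
        from ∀-classical λ y → from ⇒-classical λ y∈Y →
          let z , ch , z∈Y = infinite-child fb y (lower y∈Y)
              y⊑z , z⋢y = child-strict {y} {z} ch
              x , x∈X , y⊑x = ¬finite⇒inhabited (lower y∈Y)
          in (z , lift z∈Y , lift y⊑z , z⋢y ∘ lower) , (x , lift x∈X , lift y⊑x)

    sat-relativized : (ν : Vec Node m) (μ : Vec (Pred Node 0ℓ) n) (φ : Formula k m n) →
                      C.Sat ν μ φ ⇔ Sat ν μ (relativized φ)
    sat-relativized ν μ (P a x)  = mk⇔ id id
    sat-relativized ν μ (x ≤ᶠ y) = mk⇔ id id
    sat-relativized ν μ (x ∈ᶠ X) = mk⇔ id id
    sat-relativized ν μ (¬ᶠ φ)   = ¬⇔ (sat-relativized ν μ φ)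
    sat-relativized ν μ (φ ∧ᶠ ψ) =
      mk⇔ (λ (s , t) → to (sat-relativized ν μ φ) s , to (sat-relativized ν μ ψ) t)
          (λ (s , t) → from (sat-relativized ν μ φ) s , from (sat-relativized ν μ ψ) t)
    sat-relativized ν μ (∃¹ φ) =
      mk⇔ (λ (x , s) → x , to (sat-relativized (x ∷ ν) μ φ) s)
          (λ (x , s) → x , from (sat-relativized (x ∷ ν) μ φ) s)
    sat-relativized ν μ (∃² φ) =
      mk⇔ (λ (X , inf , s) → X , tt , from (sat-infinite ν μ X) inf , to (sat-relativized ν (X ∷ μ) φ) s)
          (λ (X , _ , i , s) → X , to (sat-infinite ν μ X) i , from (sat-relativized ν (X ∷ μ) φ) s)

  coWMSO≤MSO : coWMSO ≤[ FinitelyBranchingKripkeTrees ] MSO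
  coWMSO≤MSO k φ = relativized φ , λ K fb → RelativizedSemantics.sat-relativized K fb [] [] φ

  -- Labelled binary trees

  binaryTree : Tree
  binaryTree = record
    { Nodes         = Binary
    ; root          = []
    ; root∈         = []
    ; rooted        = λ τ _ → τ , refl
    ; prefix-closed = λ { τ τ′ τ∈ (ρ , refl) → All.++⁻ˡ τ′ τ∈ }
    }

  open Tree binaryTree using () renaming (Node to BinaryNode)

  binaryChild : BinaryNode → ∀ i → .(i ≤ 1) → BinaryNode
  binaryChild (w ,ᴿ [ w∈ ]) i i≤1 = (w ∷ʳ i) ,ᴿ [ All.++⁺ w∈ (i≤1 ∷ []) ]

  labelled : Labelling → KripkeTree 1
  labelled L = record
    { tree        = binaryTree
    ; nonBlocking = λ x → binaryChild x 0 z≤n , 0 , refl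
    ; Lab         = λ x → L (value x) ∷ []
    }

  labelled-fb : ∀ L → FinitelyBranching (labelled L)
  labelled-fb L x = binaryChild x 0 z≤n ∷ binaryChild x 1 ≤-refl ∷ [] , covers
    where
    covers : ∀ y → Tree.Child binaryTree x y → y ∈ˡ binaryChild x 0 z≤n ∷ binaryChild x 1 ≤-refl ∷ []
    covers y (zero  , y≡) = here (value-injective y≡)
    covers y (suc zero , y≡) = there (here (value-injective y≡))
    covers (_ ,ᴿ [ y∈ ]) (suc (suc i) , refl) =
      contradiction (All.head (All.++⁻ʳ (value x) (recompute (all? (_≤? 1) _) y∈))) λ { (s≤s ()) }

  -- Words outside the tree go to the root, so an enumeration of all words yields one of all nodes.
  toNode : Word → BinaryNode
  toNode w with all? (_≤? 1) w
  ... | yes w∈ = w ,ᴿ [ w∈ ]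
  ... | no  _  = [] ,ᴿ [ [] ]

  toNode-value : ∀ x → toNode (value x) ≡ x
  toNode-value (w ,ᴿ [ w∈ ]) with all? (_≤? 1) w
  ... | yes _  = refl
  ... | no  w∉ = contradiction (recompute (all? (_≤? 1) w) w∈) w∉

  countable-BinaryNode : Countable BinaryNode
  countable-BinaryNode with countable-List {ℕ} (id , λ i → i , refl)
  ... | e , onto = toNode ∘ e , λ x →
    proj₁ (onto (value x)) , trans (cong toNode (proj₂ (onto (value x)))) (toNode-value x)

  -- WMSO-definable sets of labellings

  finite-list : {X : Pred A 0ℓ} → Finite X → ∃[ xs ] (∀ x → x ∈ X ⇔ x ∈ˡ xs)
  finite-list {X = X} (xs , covers) = filter (λ x → em _ {X x}) xs , λ x → mk⇔
    (λ x∈X → ∈-filter⁺ (λ x → em _ {X x}) (covers x x∈X) x∈X)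
    (λ x∈ → proj₂ (∈-filter⁻ (λ x → em _ {X x}) {xs = xs} x∈))

  -- Analytic sets are not closed under complement, so the induction carries each set together with
  -- its complement, and negation swaps the two. Quantifiers become countable unions and
  -- intersections.
  analytic-WMSO : (ν : Vec BinaryNode m) (μ : Vec (Pred BinaryNode 0ℓ) n) (φ : Formula 1 m n) →
                  let Q = λ L → Semantics.Sat WMSO (labelled L) ν μ φ
                  in Analytic Q × Analytic (λ L → ¬ Q L)
  analytic-WMSO ν μ (P a x) = analytic-resp (λ _ → mk⇔ lift lower) (analytic-clopen d (dep (a ∈ˢ_))) ,
    analytic-resp (λ _ → ¬⇔ (mk⇔ lift lower)) (analytic-clopen d (dep λ v → ¬ (a ∈ˢ v)))
    where
    -- One more than the length of the only word whose label matters, since the labels visible below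
    -- a bound are those of strictly shorter words.
    d = suc (length (value (lookup ν x)))
    dep : (S : Subset 1 → Set) {L M : Labelling} → L ≋⟨ d ⟩ M →
          S (L (value (lookup ν x)) ∷ []) → S (M (value (lookup ν x)) ∷ [])
    dep S L≈M = subst (λ b → S (b ∷ [])) (L≈M (value (lookup ν x)) ≤-refl)
  analytic-WMSO ν μ (x ≤ᶠ y) = analytic-resp (λ _ → mk⇔ lift lower) (analytic-clopen 0 λ _ → id) ,
    analytic-resp (λ _ → ¬⇔ (mk⇔ lift lower)) (analytic-clopen 0 λ _ → id)
  analytic-WMSO ν μ (x ∈ᶠ X) = analytic-resp (λ _ → mk⇔ lift lower) (analytic-clopen 0 λ _ → id) ,
    analytic-resp (λ _ → ¬⇔ (mk⇔ lift lower)) (analytic-clopen 0 λ _ → id)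
  analytic-WMSO ν μ (¬ᶠ φ) with analytic-WMSO ν μ φ
  ... | a , ¬a = ¬a , analytic-resp (λ _ → mk⇔ (λ q ¬q → ¬q q) stable) a
  analytic-WMSO ν μ (φ ∧ᶠ ψ) with analytic-WMSO ν μ φ | analytic-WMSO ν μ ψ
  ... | a , ¬a | b , ¬b = analytic-× a b , analytic-resp
    (λ _ → mk⇔ (λ { (inj₁ ¬q) (q , _) → ¬q q ; (inj₂ ¬r) (_ , r) → ¬r r })
               (λ ¬qr → stable λ neither → neither (inj₁ λ q → neither (inj₂ λ r → ¬qr (q , r)))))
    (analytic-⊎ ¬a ¬b)
  analytic-WMSO ν μ (∃¹ φ) =
    analytic-∃ countable-BinaryNode (λ x → proj₁ (analytic-WMSO (x ∷ ν) μ φ)) ,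
    analytic-resp (λ _ → mk⇔ (λ f (x , s) → f x s) (λ s x t → s (x , t)))
      (analytic-∀ countable-BinaryNode (λ x → proj₂ (analytic-WMSO (x ∷ ν) μ φ)))
  analytic-WMSO {m} {n} ν μ (∃² φ) =
    -- A finite set of nodes is the set of members of a list, and there are countably many lists.
    analytic-resp byList (analytic-∃ (countable-List countable-BinaryNode)
      (λ xs → proj₁ (analytic-WMSO ν ((_∈ˡ xs) ∷ μ) φ))) ,
    analytic-resp (λ L → mk⇔ (λ f → λ s → let xs , t = from (byList L) s in f xs t)
                             (λ s xs t → s (to (byList L) (xs , t))))
      (analytic-∀ (countable-List countable-BinaryNode)
        (λ xs → proj₂ (analytic-WMSO ν ((_∈ˡ xs) ∷ μ) φ)))
    where
    byList : ∀ L → let open Semantics WMSO (labelled L) in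
             (∃[ xs ] Sat ν ((_∈ˡ xs) ∷ μ) φ) ⇔ Sat ν μ (∃² φ)
    byList L = mk⇔
      (λ (xs , s) → (_∈ˡ xs) , (xs , λ _ → id) , s)
      (λ (X , fin , s) → let xs , X⇔xs = finite-list fin in xs ,
         to (sat-ext WMSO (labelled L) ν (X ∷ μ) ((_∈ˡ xs) ∷ μ) φ
               λ { zero → X⇔xs ; (suc Y) _ → mk⇔ id id }) s)

  -- An infinite chain of labelled nodes

  infiniteChain : Sentence 1
  infiniteChain = ∃² ((∀¹ (zero ∈ᶠ zero ⇒ᶠ P zero zero)) ∧ᶠ
    (∀¹ (∀¹ (zero ∈ᶠ zero ∧ᶠ suc zero ∈ᶠ zero ⇒ᶠ zero ≤ᶠ suc zero ∨ᶠ suc zero ≤ᶠ zero))))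

  InfiniteChain : Labelling → Set₁
  InfiniteChain L = Σ[ X ∈ Pred BinaryNode 0ℓ ] (¬ Finite X × (∀ x → x ∈ X → L (value x) ≡ true) ×
    (∀ x y → x ∈ X → y ∈ X → value x ⊑ value y ⊎ value y ⊑ value x))

  sat-infiniteChain : ∀ L → (labelled L ⊨[ coWMSO ] infiniteChain) ⇔ InfiniteChain L
  sat-infiniteChain L = mk⇔
    (λ (X , inf , p , c) → X , inf ,
      (λ x x∈X → []=⇒lookup (lower (to ⇒-classical (to ∀-classical p x) (lift x∈X)))) ,
      (λ x y x∈X y∈X → Sum.map lower lower
        (to ∨-classical (to ⇒-classical (to ∀-classical (to ∀-classical c y) x) (lift x∈X , lift y∈X)))))
    (λ (X , inf , p , c) → X , inf ,
      (from ∀-classical λ x → from ⇒-classical λ x∈X →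
        lift (lookup⇒[]= zero (L (value x) ∷ []) (p x (lower x∈X)))) ,
      (from ∀-classical λ y → from ∀-classical λ x → from ⇒-classical λ (x∈X , y∈X) →
        from ∨-classical (Sum.map lift lift (c x y (lower x∈X) (lower y∈X)))))

  finite-below : ∀ (y : BinaryNode) → Finite {BinaryNode} (λ x → value x ⊑ value y)
  finite-below y = List.map toNode (prefixes (value y)) , λ x x⊑y →
    subst (_∈ˡ List.map toNode (prefixes (value y))) (toNode-value x) (∈-map⁺ toNode (⊑⇒∈prefixes x⊑y))

  -- The node code s is labelled iff the stages up to |s| hold along s; these
  -- depend only on the labels above it, so some labelling is its own image.
  module Diagonal {Q : Labelling → Set ℓ} (a : Analytic Q) where

    Marked : Labelling → Pred Word 0ℓ
    Marked L w = ∃[ s ] (w ≡ code s × ∀ m → m ≤ length s → a .Stage m (entry s) L)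

    mark : Labelling → Labelling
    mark L w = does (em _ {Marked L w})

    -- With `w` the code of `s`, the bounds `m ≤ length s ≤ length (code s) ≤ n` confine stage `m`
    -- to labels on which `L` and `M` agree.
    Marked-local : ∀ {L M n} → L ≋⟨ n ⟩ M → ∀ w → length w < suc n → Marked L w → Marked M w
    Marked-local L≈M _ (s≤s w≤n) (s , refl , st) = s , refl , λ m m≤ →
      a .local (λ _ _ → refl)
        (λ v v<m → L≈M v (<-≤-trans v<m (≤-trans m≤ (≤-trans (length-code s) w≤n)))) (st m m≤)

    mark-contractive : ∀ {L M n} → L ≋⟨ n ⟩ M → mark L ≋⟨ suc n ⟩ mark M
    mark-contractive L≈M w w< = does-⇔
      (mk⇔ (Marked-local L≈M w w<) (Marked-local (λ v v< → sym (L≈M v v<)) w w<)) (em _) (em _)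

    iterate : ℕ → Labelling
    iterate zero    = λ _ → false
    iterate (suc n) = mark (iterate n)

    iterate-agree : ∀ {n m} → n ≤ m → iterate n ≋⟨ n ⟩ iterate m
    iterate-agree z≤n       w ()
    iterate-agree (s≤s n≤m) = mark-contractive (iterate-agree n≤m)

    -- The fixed point of the contraction `mark`: the label of a word is final once the number of
    -- iterations exceeds its length.
    fixed : Labelling
    fixed w = iterate (suc (length w)) w

    fixed-mark : ∀ w → fixed w ≡ mark fixed w
    fixed-mark w = sym (mark-contractive {fixed} {iterate (length w)}
      (λ v v<n → iterate-agree v<n v ≤-refl) w ≤-refl)

    -- The marked nodes of the chain decode to pairwise comparable sequences of unbounded length.
    -- These converge to `α`, which inherits each stage `m` from a sequence of length at least `m`.
    chain⇒branch : InfiniteChain fixed → Σ[ α ∈ Sequence ] (∀ n → a .Stage n α fixed)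
    chain⇒branch (X , inf , labels , chain) = α , λ m → a .local (coherent m) (λ _ _ → refl)
        (proj₂ (proj₂ (marks (proj₁ (far m)) (proj₁ (proj₂ (far m))))) m (proj₂ (proj₂ (far m))))
      where
      marks : ∀ x → x ∈ X → Marked fixed (value x)
      marks x x∈X = does-true (em _) (trans (sym (fixed-mark (value x))) (labels x x∈X))

      seq : ∀ x → x ∈ X → List ℕ
      seq x x∈X = proj₁ (marks x x∈X)

      seq-chain : ∀ x y (x∈X : x ∈ X) (y∈X : y ∈ X) → seq x x∈X ⊑ seq y y∈X ⊎ seq y y∈X ⊑ seq x x∈X
      seq-chain x y x∈X y∈X with marks x x∈X | marks y y∈X | chain x y x∈X y∈X
      ... | s , refl , _ | t , refl , _ | c = Sum.map (code-reflects s t) (code-reflects t s) c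

      longer : ∀ x (x∈X : x ∈ X) → ∃[ y ] Σ[ y∈X ∈ y ∈ X ] length (seq x x∈X) < length (seq y y∈X)
      -- Only finitely many nodes are prefixes of `x`, so `X` has a member that is not one; by
      -- comparability it properly extends `x`.
      longer x x∈X with ¬finite⇒inhabited {X = λ y → y ∈ X × ¬ (value y ⊑ value x)}
        (λ fin → inf (finite-∪ split (finite-below x) fin))
        where
        split : ∀ y → y ∈ X → value y ⊑ value x ⊎ (y ∈ X × ¬ (value y ⊑ value x))
        split y y∈X with em _ {value y ⊑ value x}
        ... | yes p = inj₁ p
        ... | no ¬p = inj₂ (y∈X , ¬p)
      ... | y , y∈X , y⋢x = y , y∈X , strict
        where
        strict : length (seq x x∈X) < length (seq y y∈X)
        strict with marks x x∈X | marks y y∈X | chain x y x∈X y∈X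
        ... | s , refl , _ | t , y≡ , _ | inj₂ y⊑x = contradiction y⊑x y⋢x
        ... | s , x≡ , _ | t , y≡ , _ | inj₁ x⊑y rewrite x≡ | y≡ =
          ⊑∧⋢⇒length< (code-reflects s t x⊑y) (y⋢x ∘ code-mono)

      far : ∀ n → ∃[ x ] Σ[ x∈X ∈ x ∈ X ] n ≤ length (seq x x∈X)
      far zero    = let x , x∈X = ¬finite⇒inhabited inf in x , x∈X , z≤n
      far (suc n) = let x , x∈X , n≤ = far n
                        y , y∈X , lt = longer x x∈X
                    in y , y∈X , ≤-<-trans n≤ lt

      farSeq : ℕ → List ℕ
      farSeq n = seq (proj₁ (far n)) (proj₁ (proj₂ (far n)))

      α : Sequence
      -- `farSeq (suc i)` has length at least `suc i`, so position `i` holds a genuine entry and not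
      -- the default.
      α i = entry (farSeq (suc i)) i

      coherent : ∀ m → entry (farSeq m) ≈⟨ m ⟩ α
      coherent m i i<m with seq-chain _ _ (proj₁ (proj₂ (far m))) (proj₁ (proj₂ (far (suc i))))
      ... | inj₁ p = entry-⊑ p i (<-≤-trans i<m (proj₂ (proj₂ (far m))))
      ... | inj₂ p = sym (entry-⊑ p i (proj₂ (proj₂ (far (suc i)))))

    -- The codes of the finite prefixes of `α` form the chain; they are marked because all stages
    -- hold along `α`.
    branch⇒chain : (Σ[ α ∈ Sequence ] ∀ n → a .Stage n α fixed) → InfiniteChain fixed
    branch⇒chain (α , stages) = X , unbounded⇒¬finite (length ∘ value) deep , labels , chain
      where
      X : Pred BinaryNode 0ℓ
      X x = ∃[ n ] value x ≡ code (applyUpTo α n)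
      deep : ∀ b → ∃[ x ] (x ∈ X × b ≤ length (value x))
      deep b = (code (applyUpTo α b) ,ᴿ [ code-binary (applyUpTo α b) ]) , (b , refl) ,
        subst (_≤ length (code (applyUpTo α b))) (length-applyUpTo α b) (length-code (applyUpTo α b))
      labels : ∀ x → x ∈ X → fixed (value x) ≡ true
      labels x (n , eq) = trans (fixed-mark (value x)) (dec-true (em _) (applyUpTo α n , eq , λ m m≤ →
        a .local (λ i i<m → sym (entry-applyUpTo α n i
                    (<-≤-trans i<m (subst (m ≤_) (length-applyUpTo α n) m≤))))
                 (λ _ _ → refl) (stages m)))
      chain : ∀ x y → x ∈ X → y ∈ X → value x ⊑ value y ⊎ value y ⊑ value x
      chain (_ ,ᴿ _) (_ ,ᴿ _) (m , refl) (n , refl) with ≤-total m n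
      ... | inj₁ m≤n = inj₁ (code-mono (applyUpTo-⊑ α m≤n))
      ... | inj₂ n≤m = inj₂ (code-mono (applyUpTo-⊑ α n≤m))

  coWMSO≰WMSO : ¬ (coWMSO ≤[ FinitelyBranchingKripkeTrees ] WMSO)
  coWMSO≰WMSO le with le 1 infiniteChain
  ... | φ , equivalent = ¬sat (from diagonal ¬sat)
    where
    nonSat : Analytic (λ L → ¬ (labelled L ⊨[ WMSO ] φ))
    nonSat = proj₂ (analytic-WMSO [] [] φ)
    open Diagonal nonSat
    chain⇔sat : InfiniteChain fixed ⇔ (labelled fixed ⊨[ WMSO ] φ)
    chain⇔sat = mk⇔
      (to (equivalent (labelled fixed) (labelled-fb fixed)) ∘ from (sat-infiniteChain fixed))
      (to (sat-infiniteChain fixed) ∘ from (equivalent (labelled fixed) (labelled-fb fixed)))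
    -- On `fixed`, an infinite chain amounts to a branch through the stages for the negation of `φ`,
    -- so `φ` holds exactly when it fails.
    diagonal : (labelled fixed ⊨[ WMSO ] φ) ⇔ (¬ (labelled fixed ⊨[ WMSO ] φ))
    diagonal = mk⇔
      (from (nonSat .branch fixed) ∘ chain⇒branch ∘ from chain⇔sat)
      (to chain⇔sat ∘ branch⇒chain ∘ to (nonSat .branch fixed))
    ¬sat : ¬ (labelled fixed ⊨[ WMSO ] φ)
    ¬sat s = to diagonal s s

  -- Counting up to a threshold

  infixl 7 _∖_

  _∖_ : Pred A 0ℓ → A → Pred A 0ℓ
  (Q ∖ x) y = Q y × y ≢ x

  AtLeast : ℕ → Pred A 0ℓ → Set
  AtLeast zero    Q = ⊤
  AtLeast (suc s) Q = ∃[ x ] (x ∈ Q × AtLeast s (Q ∖ x))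

  infix 4 _≈[_]_

  -- Equality of cardinalities, with all cardinalities from `t` on identified.
  _≈[_]_ : Pred A 0ℓ → ℕ → Pred B 0ℓ → Set
  Q ≈[ t ] R = ∀ s → s ≤ t → AtLeast s Q ⇔ AtLeast s R

  atLeast-⊆ : ∀ s {Q R : Pred A 0ℓ} → (∀ x → x ∈ Q → x ∈ R) → AtLeast s Q → AtLeast s R
  atLeast-⊆ zero    Q⊆R _            = tt
  atLeast-⊆ (suc s) Q⊆R (x , qx , h) = x , Q⊆R x qx , atLeast-⊆ s (λ y (qy , y≢x) → Q⊆R y qy , y≢x) h

  -- If the element chosen first is not `x`, it is kept and `x` is removed from the remaining
  -- choices.
  atLeast-∖ : ∀ s {Q : Pred A 0ℓ} {x} → x ∈ Q → AtLeast (suc s) Q → AtLeast s (Q ∖ x)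
  atLeast-∖ zero    qx _ = tt
  atLeast-∖ (suc s) {Q} {x} qx (y , qy , h) with em _ {x ≡ y}
  ... | yes refl = h
  ... | no  x≢y  = y , (qy , x≢y ∘ sym) , atLeast-⊆ s (λ z ((qz , z≢y) , z≢x) → (qz , z≢x) , z≢y)
                     (atLeast-∖ s (qx , x≢y) h)

  atLeast-injection : ∀ s {Q : Pred A 0ℓ} (f : Fin s → A) → (∀ {i j} → f i ≡ f j → i ≡ j) →
                      (∀ i → f i ∈ Q) → AtLeast s Q
  atLeast-injection zero    f inj q = tt
  atLeast-injection (suc s) f inj q = f zero , q zero ,
    atLeast-injection s (f ∘ suc) (Fin-suc-injective ∘ inj) λ i → q (suc i) , λ eq → case inj eq of λ ()

  ≈-sym : {Q : Pred A 0ℓ} {R : Pred B 0ℓ} → Q ≈[ t ] R → R ≈[ t ] Q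
  ≈-sym e s s≤t = mk⇔ (from (e s s≤t)) (to (e s s≤t))

  ≈-≤ : {Q : Pred A 0ℓ} {R : Pred B 0ℓ} → t₁ ≤ t₂ → Q ≈[ t₂ ] R → Q ≈[ t₁ ] R
  ≈-≤ t₁≤t₂ e s s≤t = e s (≤-trans s≤t t₁≤t₂)

  ≈-resp : {Q Q′ : Pred A 0ℓ} {R R′ : Pred B 0ℓ} → (∀ x → x ∈ Q ⇔ x ∈ Q′) → (∀ x → x ∈ R ⇔ x ∈ R′) →
           Q ≈[ t ] R → Q′ ≈[ t ] R′
  ≈-resp q r e s s≤t = mk⇔
    (λ h → atLeast-⊆ s (to ∘ r) (to (e s s≤t) (atLeast-⊆ s (from ∘ q) h)))
    (λ h → atLeast-⊆ s (to ∘ q) (from (e s s≤t) (atLeast-⊆ s (from ∘ r) h)))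

  ≈-zero : {Q : Pred A 0ℓ} {R : Pred B 0ℓ} → Q ≈[ 0 ] R
  ≈-zero zero _ = mk⇔ id id

  ≈-empty : {Q : Pred A 0ℓ} {R : Pred B 0ℓ} → (∀ x → ¬ Q x) → (∀ x → ¬ R x) → Q ≈[ t ] R
  ≈-empty ¬q ¬r zero    _ = mk⇔ id id
  ≈-empty ¬q ¬r (suc s) _ = mk⇔
    (λ (x , qx , _) → contradiction qx (¬q x))
    (λ (x , rx , _) → contradiction rx (¬r x))

  ≈-inhabited : {Q : Pred A 0ℓ} {R : Pred B 0ℓ} → 1 ≤ t → Q ≈[ t ] R → ∀ {x} → x ∈ Q → ∃[ y ] y ∈ R
  ≈-inhabited 1≤t e {x} qx with to (e 1 1≤t) (x , qx , tt)
  ... | y , ry , _ = y , ry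

  ≈-∖ : {Q : Pred A 0ℓ} {R : Pred B 0ℓ} → ∀ {x y} → x ∈ Q → y ∈ R → Q ≈[ suc t ] R → Q ∖ x ≈[ t ] R ∖ y
  ≈-∖ {x = x} {y} qx ry e s s≤t = mk⇔
    (λ h → atLeast-∖ s ry (to (e (suc s) (s≤s s≤t)) (x , qx , h)))
    (λ h → atLeast-∖ s qx (from (e (suc s) (s≤s s≤t)) (y , ry , h)))

  ≈-∖⁻ : {Q : Pred A 0ℓ} {R : Pred B 0ℓ} → ∀ {x y} → x ∈ Q → y ∈ R → Q ∖ x ≈[ t ] R ∖ y → Q ≈[ suc t ] R
  ≈-∖⁻ qx ry e zero    _ = mk⇔ id id
  ≈-∖⁻ {x = x} {y} qx ry e (suc s) (s≤s s≤t) = mk⇔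
    (λ h → y , ry , to (e s s≤t) (atLeast-∖ s qx h))
    (λ h → x , qx , from (e s s≤t) (atLeast-∖ s ry h))

  -- The reply `Y` to the set `X` is built by pairing off elements, first up to `t₁` inside `X`,
  -- then up to `t₂` outside, each pair costing one unit of the threshold. If one side runs out
  -- early, its counterpart is made empty.
  ≈-split : ∀ t₁ t₂ {Q : Pred A 0ℓ} {R : Pred B 0ℓ} (X : Pred A 0ℓ) → Q ≈[ t₁ + t₂ ] R →
            Σ[ Y ∈ Pred B 0ℓ ] (Q ∩ X ≈[ t₁ ] R ∩ Y × Q ∩ ∁ X ≈[ t₂ ] R ∩ ∁ Y)
  ≈-split zero zero X e = X₀ , ≈-zero , ≈-zero
    where X₀ = λ _ → ⊥
  ≈-split zero (suc t₂) {Q} {R} X e with em _ {∃[ x ] x ∈ Q ∩ ∁ X}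
  ... | no none = U , ≈-zero , ≈-empty (λ x qx → none (x , qx)) (λ _ (_ , ¬u) → ¬u tt)
  ... | yes (x , qx , x∉X) with ≈-inhabited (s≤s z≤n) e qx
  ... | y , ry with ≈-split zero t₂ X (≈-∖ qx ry e)
  ... | Y , _ , e₂ = Y ∖ y , ≈-zero , ≈-∖⁻ (qx , x∉X) (ry , λ (_ , y≢y) → y≢y refl)
    (≈-resp (λ _ → mk⇔ (λ ((q , z≢) , z∉) → (q , z∉) , z≢) (λ ((q , z∉) , z≢) → (q , z≢) , z∉))
            (λ _ → mk⇔ (λ ((r , z≢) , z∉) → (r , z∉ ∘ proj₁) , z≢)
                       (λ ((r , z∉) , z≢) → (r , z≢) , λ z∈ → z∉ (z∈ , z≢)))
            e₂)
  ≈-split (suc t₁) t₂ {Q} {R} X e with em _ {∃[ x ] x ∈ Q ∩ X}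
  ... | no none = (λ _ → ⊥) , ≈-empty (λ x qx → none (x , qx)) (λ _ → proj₂) ,
    ≈-resp (λ x → mk⇔ (λ q → q , λ x∈X → none (x , q , x∈X)) proj₁) (λ _ → mk⇔ (_, id) proj₁)
           (≈-≤ (m≤n+m t₂ (suc t₁)) e)
  ... | yes (x , qx , x∈X) with ≈-inhabited (s≤s z≤n) e qx
  ... | y , ry with ≈-split t₁ t₂ X (≈-∖ qx ry e)
  ... | Y , e₁ , e₂ = (λ z → Y z ⊎ z ≡ y) ,
    ≈-∖⁻ (qx , x∈X) (ry , inj₂ refl)
      (≈-resp (λ _ → mk⇔ (λ ((q , z≢) , z∈) → (q , z∈) , z≢) (λ ((q , z∈) , z≢) → (q , z≢) , z∈))
              (λ _ → mk⇔ (λ ((r , z≢) , z∈) → (r , inj₁ z∈) , z≢)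
                         (λ { ((r , inj₁ z∈) , z≢) → (r , z≢) , z∈ ; ((r , inj₂ z≡) , z≢) → contradiction z≡ z≢ }))
              e₁) ,
    ≈-resp (λ _ → mk⇔ (λ ((q , _) , z∉) → q , z∉) (λ (q , z∉) → (q , λ { refl → z∉ x∈X }) , z∉))
           (λ _ → mk⇔ (λ ((r , z≢) , z∉) → r , [ z∉ , z≢ ]′) (λ (r , z∉) → (r , z∉ ∘ inj₂) , z∉ ∘ inj₁))
           e₂

  -- Classes are split bit by bit, and each bit halves the threshold; hence the factor `2 ^ l`.
  ≈-recolour : ∀ l t {Q : Pred A 0ℓ} {R : Pred B 0ℓ} (c : A → Vec Bool l) → Q ≈[ 2 ^ l * t ] R →
               Σ[ d ∈ (B → Vec Bool l) ] (∀ v → (λ x → Q x × c x ≡ v) ≈[ t ] (λ y → R y × d y ≡ v))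
  ≈-recolour zero t c e = (λ _ → []) , λ { [] →
    ≈-resp (λ x → mk⇔ (_, []-unique (c x)) proj₁) (λ _ → mk⇔ (_, refl) proj₁)
           (≈-≤ (≤-reflexive (sym (+-identityʳ t))) e) }
    where
    []-unique : (v : Vec Bool 0) → v ≡ []
    []-unique [] = refl
  ≈-recolour {A} {B} (suc l) t {Q} {R} c e = d , counts
    where
    X : Pred A 0ℓ
    X x = Vec.head (c x) ≡ true
    double : 2 ^ l * t + 2 ^ l * t ≡ 2 ^ suc l * t
    double = trans (sym (*-distribʳ-+ t (2 ^ l) (2 ^ l)))
                   (cong (λ z → (2 ^ l + z) * t) (sym (+-identityʳ (2 ^ l))))
    splitting = ≈-split (2 ^ l * t) (2 ^ l * t) X (≈-≤ (≤-reflexive double) e)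
    Y = proj₁ splitting
    in-X  = ≈-recolour l t (Vec.tail ∘ c) (proj₁ (proj₂ splitting))
    out-X = ≈-recolour l t (Vec.tail ∘ c) (proj₂ (proj₂ splitting))
    d : B → Vec Bool (suc l)
    d y with em _ {y ∈ Y}
    ... | yes _ = true ∷ proj₁ in-X y
    ... | no  _ = false ∷ proj₁ out-X y
    split-c : ∀ x b v → (Vec.head (c x) ≡ b × Vec.tail (c x) ≡ v) ⇔ (c x ≡ b ∷ v)
    split-c x b v with c x
    ... | _ ∷ _ = mk⇔ (λ { (refl , refl) → refl }) (λ { refl → refl , refl })
    not-X : ∀ x → (x ∈ ∁ X) ⇔ (Vec.head (c x) ≡ false)
    not-X x with Vec.head (c x)
    ... | true  = mk⇔ (λ h → contradiction refl h) (λ ())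
    ... | false = mk⇔ (λ _ → refl) (λ _ ())
    d-true : ∀ y v → ((y ∈ R × y ∈ Y) × proj₁ in-X y ≡ v) ⇔ (y ∈ R × d y ≡ true ∷ v)
    d-true y v with em _ {y ∈ Y}
    ... | yes y∈ = mk⇔ (λ ((r , _) , eq) → r , cong (true ∷_) eq) (λ (r , eq) → (r , y∈) , ∷-injectiveʳ eq)
    ... | no  y∉ = mk⇔ (λ ((_ , y∈) , _) → contradiction y∈ y∉) (λ { (_ , ()) })
    d-false : ∀ y v → ((y ∈ R × ¬ (y ∈ Y)) × proj₁ out-X y ≡ v) ⇔ (y ∈ R × d y ≡ false ∷ v)
    d-false y v with em _ {y ∈ Y}
    ... | yes y∈ = mk⇔ (λ ((_ , y∉) , _) → contradiction y∈ y∉) (λ { (_ , ()) })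
    ... | no  y∉ = mk⇔ (λ ((r , _) , eq) → r , cong (false ∷_) eq) (λ (r , eq) → (r , y∉) , ∷-injectiveʳ eq)
    counts : ∀ v → (λ x → Q x × c x ≡ v) ≈[ t ] (λ y → R y × d y ≡ v)
    counts (true ∷ v) = ≈-resp
      (λ x → mk⇔ (λ ((q , x∈) , eq) → q , to (split-c x true v) (x∈ , eq))
                 (λ (q , eq) → let h , tl = from (split-c x true v) eq in (q , h) , tl))
      (λ y → d-true y v) (proj₂ in-X v)
    counts (false ∷ v) = ≈-resp
      (λ x → mk⇔ (λ ((q , x∉) , eq) → q , to (split-c x false v) (to (not-X x) x∉ , eq))
                 (λ (q , eq) → let h , tl = from (split-c x false v) eq in (q , from (not-X x) h) , tl))
      (λ y → d-false y v) (proj₂ out-X v)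

  -- Types of chains

  bit : Set ℓ → Bool
  bit Q = does (em _ {Q})

  bit-cong : {Q : Set ℓ} {R : Set ℓ′} → Q ⇔ R → bit Q ≡ bit R
  bit-cong Q⇔R = does-⇔ Q⇔R (em _) (em _)

  bit-injective : {Q : Set ℓ} {R : Set ℓ′} → bit Q ≡ bit R → Q → R
  bit-injective {Q = Q} {R} eq q with em _ {Q} | em _ {R}
  ... | yes _ | yes r = r
  ... | no ¬q | _     = contradiction q ¬q
  bit-injective () q | yes _ | no _

  -- The truth table of a predicate on bit vectors, which turns a set of types into a bit vector
  -- again. The trailing `[]` matches the form `2 ^ l + (2 ^ l + 0)` to which the length computes.
  table : ∀ l → (Vec Bool l → Bool) → Vec Bool (2 ^ l)
  table zero    p = p [] ∷ []
  table (suc l) p = table l (p ∘ (true ∷_)) Vec.++ (table l (p ∘ (false ∷_)) Vec.++ [])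

  table-cong : ∀ l {p q : Vec Bool l → Bool} → (∀ v → p v ≡ q v) → table l p ≡ table l q
  table-cong zero    e = cong (_∷ []) (e [])
  table-cong (suc l) e = cong₂ (λ v w → v Vec.++ (w Vec.++ []))
    (table-cong l (e ∘ (true ∷_))) (table-cong l (e ∘ (false ∷_)))

  table-injective : ∀ l {p q : Vec Bool l → Bool} → table l p ≡ table l q → ∀ v → p v ≡ q v
  table-injective zero eq [] = ∷-injectiveˡ eq
  table-injective (suc l) {p} {q} eq v with ++-injective (table l (p ∘ (true ∷_))) (table l (q ∘ (true ∷_))) eq
  table-injective (suc l) eq (true ∷ v)  | eq₁ , _ = table-injective l eq₁ v
  table-injective (suc l) {p} {q} eq (false ∷ v) | _ , eq₂ =
    table-injective l (proj₁ (++-injective (table l (p ∘ (false ∷_))) (table l (q ∘ (false ∷_))) eq₂)) v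

  tabulate-injective : {f g : Fin n → A} → tabulate f ≡ tabulate g → ∀ i → f i ≡ g i
  tabulate-injective {f = f} {g} eq i =
    trans (sym (lookup∘tabulate f i)) (trans (cong (λ v → lookup v i) eq) (lookup∘tabulate g i))

  -- A first-order variable is represented by the set of positions it occupies, which is empty when
  -- its node lies elsewhere in the tree.
  record Chain (m n : ℕ) : Set₁ where
    constructor chain
    field
      points : Vec (Pred ℕ 0ℓ) m
      sets   : Vec (Pred ℕ 0ℓ) n

  open Chain

  addSet : Pred ℕ 0ℓ → Chain m n → Chain m (suc n)
  addSet S (chain ps Ss) = chain ps (S ∷ Ss)

  -- A first-order variable that is not interpreted in this chain adds no point.
  addPoint : Maybe ℕ → Chain m n → Chain (suc m) n
  addPoint p (chain ps Ss) = chain ((λ j → p ≡ just j) ∷ ps) Ss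

  Ordered : Chain m n → Fin m → Fin m → Set
  Ordered c a b = ∃[ i ] ∃[ j ] (lookup (points c) a i × lookup (points c) b j × i ≤ j)

  Member : Chain m n → Fin m → Fin n → Set
  Member c a X = ∃[ i ] (lookup (points c) a i × lookup (sets c) X i)

  record _≃_ (c d : Chain m n) : Set where
    constructor _,_
    field
      points≃ : ∀ a i → lookup (points c) a i ⇔ lookup (points d) a i
      sets≃   : ∀ X i → lookup (sets c) X i ⇔ lookup (sets d) X i

  open _≃_

  cons≃ : ∀ {Q R : Pred ℕ 0ℓ} {v w : Vec (Pred ℕ 0ℓ) n} → (∀ i → Q i ⇔ R i) →
          (∀ a i → lookup v a i ⇔ lookup w a i) → ∀ a i → lookup (Q ∷ v) a i ⇔ lookup (R ∷ w) a i
  cons≃ e e′ zero    = e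
  cons≃ e e′ (suc a) = e′ a

  atomSize : ℕ → ℕ → ℕ
  atomSize m n = m * m + m * n

  -- Beyond the atoms there is one bit for each candidate type of an extension by a set, and one for
  -- each candidate type of an extension by a point.
  typeSize : ℕ → ℕ → ℕ → ℕ
  typeSize zero    m n = atomSize m n
  typeSize (suc q) m n = atomSize m n + (2 ^ typeSize q m (suc n) + 2 ^ typeSize q (suc m) n)

  orderBits : Chain m n → Vec Bool (m * m)
  orderBits {m} c = tabulate λ ab → bit (Ordered c (proj₁ (remQuot {m} m ab)) (proj₂ (remQuot {m} m ab)))

  memberBits : Chain m n → Vec Bool (m * n)
  memberBits {m} {n} c = tabulate λ aX → bit (Member c (proj₁ (remQuot {m} n aX)) (proj₂ (remQuot {m} n aX)))

  atoms : Chain m n → Vec Bool (atomSize m n)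
  atoms c = orderBits c Vec.++ memberBits c

  -- The Hintikka type of rank `q`: chains of equal type cannot be told apart in `q` rounds of the
  -- game, where a point move may also leave the chain without a new point.
  type : ∀ q → Chain m n → Vec Bool (typeSize q m n)
  setTypes   : ∀ q → Chain m n → Vec Bool (typeSize q m (suc n)) → Bool
  pointTypes : ∀ q → Chain m n → Vec Bool (typeSize q (suc m) n) → Bool
  type zero    c = atoms c
  type (suc q) c = atoms c Vec.++ (table _ (setTypes q c) Vec.++ table _ (pointTypes q c))
  setTypes   q c v = bit (∃[ S ] type q (addSet S c) ≡ v)
  pointTypes q c v = bit (∃[ p ] type q (addPoint p c) ≡ v)

  module _ (c d : Chain m n) (eq : atoms c ≡ atoms d) where

    ordered-transfer : ∀ a b → Ordered c a b → Ordered d a b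
    ordered-transfer a b = bit-injective (subst
      (λ ab → bit (Ordered c (proj₁ ab) (proj₂ ab)) ≡ bit (Ordered d (proj₁ ab) (proj₂ ab)))
      (remQuot-combine {m} {m} a b)
      (tabulate-injective (proj₁ (++-injective (orderBits c) (orderBits d) eq)) (combine a b)))

    member-transfer : ∀ a X → Member c a X → Member d a X
    member-transfer a X = bit-injective (subst
      (λ aX → bit (Member c (proj₁ aX) (proj₂ aX)) ≡ bit (Member d (proj₁ aX) (proj₂ aX)))
      (remQuot-combine {m} {n} a X)
      (tabulate-injective (proj₂ (++-injective (orderBits c) (orderBits d) eq)) (combine a X)))

    -- `Ordered` of a variable with itself says that the variable occupies a position of the chain.
    point-transfer : ∀ a i → lookup (points c) a i → ∃[ j ] lookup (points d) a j
    point-transfer a i p with ordered-transfer a a (i , i , p , p , ≤-refl)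
    ... | j , _ , q , _ = j , q

  type⇒atoms : ∀ q {c d : Chain m n} → type q c ≡ type q d → atoms c ≡ atoms d
  type⇒atoms zero    eq = eq
  type⇒atoms (suc q) {c} {d} eq = proj₁ (++-injective (atoms c) (atoms d) eq)

  module _ q {c d : Chain m n} (eq : type (suc q) c ≡ type (suc q) d) where

    private
      tables = ++-injective (table _ (setTypes q c)) (table _ (setTypes q d))
        (proj₂ (++-injective (atoms c) (atoms d) eq))

    set-transfer : ∀ S → ∃[ S′ ] type q (addSet S c) ≡ type q (addSet S′ d)
    set-transfer S with bit-injective {R = ∃[ S′ ] type q (addSet S′ d) ≡ type q (addSet S c)}
      (table-injective _ {setTypes q c} {setTypes q d} (proj₁ tables) (type q (addSet S c))) (S , refl)
    ... | S′ , eq′ = S′ , sym eq′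

    maybe-point-transfer : ∀ p → ∃[ p′ ] type q (addPoint p c) ≡ type q (addPoint p′ d)
    maybe-point-transfer p with bit-injective {R = ∃[ p′ ] type q (addPoint p′ d) ≡ type q (addPoint p c)}
      (table-injective _ {pointTypes q c} {pointTypes q d} (proj₂ tables) (type q (addPoint p c))) (p , refl)
    ... | p′ , eq′ = p′ , sym eq′

    -- The reply cannot be `nothing`, since the atoms record whether the newest variable lies on the
    -- chain.
    new-point-transfer : ∀ i → ∃[ j ] type q (addPoint (just i) c) ≡ type q (addPoint (just j) d)
    new-point-transfer i with maybe-point-transfer (just i)
    ... | just j  , eq′ = j , eq′
    ... | nothing , eq′ with point-transfer (addPoint (just i) c) (addPoint nothing d)
                                             (type⇒atoms q eq′) zero i refl
    ... | _ , ()

    no-point-transfer : type q (addPoint nothing c) ≡ type q (addPoint nothing d)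
    no-point-transfer with maybe-point-transfer nothing
    ... | nothing , eq′ = eq′
    ... | just j  , eq′ with point-transfer (addPoint (just j) d) (addPoint nothing c)
                                             (sym (type⇒atoms q eq′)) zero j refl
    ... | _ , ()

  atoms-cong : {c d : Chain m n} → c ≃ d → atoms c ≡ atoms d
  atoms-cong {m} {n} {c} {d} e = cong₂ Vec._++_
    (tabulate-cong λ ab → bit-cong (ordered⇔ (proj₁ (remQuot {m} m ab)) (proj₂ (remQuot {m} m ab))))
    (tabulate-cong λ aX → bit-cong (member⇔ (proj₁ (remQuot {m} n aX)) (proj₂ (remQuot {m} n aX))))
    where
    ordered⇔ : ∀ a b → Ordered c a b ⇔ Ordered d a b
    ordered⇔ a b = mk⇔
      (λ (i , j , p , q , i≤j) → i , j , to (points≃ e a i) p , to (points≃ e b j) q , i≤j)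
      (λ (i , j , p , q , i≤j) → i , j , from (points≃ e a i) p , from (points≃ e b j) q , i≤j)
    member⇔ : ∀ a X → Member c a X ⇔ Member d a X
    member⇔ a X = mk⇔
      (λ (i , p , q) → i , to (points≃ e a i) p , to (sets≃ e X i) q)
      (λ (i , p , q) → i , from (points≃ e a i) p , from (sets≃ e X i) q)

  type-cong : ∀ q {c d : Chain m n} → c ≃ d → type q c ≡ type q d
  type-cong zero    e = atoms-cong e
  type-cong (suc q) {c} {d} e = cong₂ Vec._++_ (atoms-cong e) (cong₂ Vec._++_
    (table-cong _ {setTypes q c} {setTypes q d} λ v → bit-cong (sets⇔ v))
    (table-cong _ {pointTypes q c} {pointTypes q d} λ v → bit-cong (points⇔ v)))
    where
    set≡ : ∀ S → type q (addSet S c) ≡ type q (addSet S d)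
    set≡ S = type-cong q (points≃ e , cons≃ (λ _ → mk⇔ id id) (sets≃ e))
    point≡ : ∀ p → type q (addPoint p c) ≡ type q (addPoint p d)
    point≡ p = type-cong q (cons≃ (λ _ → mk⇔ id id) (points≃ e) , sets≃ e)
    sets⇔ : ∀ v → (∃[ S ] type q (addSet S c) ≡ v) ⇔ (∃[ S ] type q (addSet S d) ≡ v)
    sets⇔ v = mk⇔ (λ (S , eq) → S , trans (sym (set≡ S)) eq) (λ (S , eq) → S , trans (set≡ S) eq)
    points⇔ : ∀ v → (∃[ p ] type q (addPoint p c) ≡ v) ⇔ (∃[ p ] type q (addPoint p d) ≡ v)
    points⇔ v = mk⇔ (λ (p , eq) → p , trans (sym (point≡ p)) eq) (λ (p , eq) → p , trans (point≡ p) eq)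

  -- Fans: a root carrying I-many chains

  open KripkeTree using (Node; Descendant)

  infix 4 _≼_

  -- `nothing` stands for the root and `just (i , a)` for position `a` on chain `i`.
  _≼_ : Maybe (I × ℕ) → Maybe (I × ℕ) → Set
  nothing      ≼ _             = ⊤
  just _       ≼ nothing       = ⊥
  just (i , a) ≼ just (j , b) = i ≡ j × a ≤ b

  record Fan (K : KripkeTree 0) (I : Set) : Set where
    field
      at           : Maybe (I × ℕ) → Node K
      at-onto      : ∀ x → ∃[ p ] at p ≡ x
      at-injective : ∀ {p r} → at p ≡ at r → p ≡ r
      at-order     : ∀ p r → Descendant K (at p) (at r) ⇔ p ≼ r

  module Positions {K : KripkeTree 0} (F : Fan K I) where
    open Fan F

    pointOn : I → Node K → Pred ℕ 0ℓ
    pointOn i x a = at (just (i , a)) ≡ x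

    setOn : I → Pred (Node K) 0ℓ → Pred ℕ 0ℓ
    setOn i X a = at (just (i , a)) ∈ X

    chainAt : Vec (Node K) m → Vec (Pred (Node K) 0ℓ) n → I → Chain m n
    chainAt ν μ i = chain (Vec.map (pointOn i) ν) (Vec.map (setOn i) μ)

    point⇔ : ∀ (ν : Vec (Node K) m) (μ : Vec (Pred (Node K) 0ℓ) n) i x a →
             lookup (Chain.points (chainAt ν μ i)) x a ⇔ (at (just (i , a)) ≡ lookup ν x)
    point⇔ ν μ i x a = subst (λ Q → Q a ⇔ pointOn i (lookup ν x) a) (sym (lookup-map x (pointOn i) ν)) (mk⇔ id id)

    set⇔ : ∀ (ν : Vec (Node K) m) (μ : Vec (Pred (Node K) 0ℓ) n) i X a →
           lookup (Chain.sets (chainAt ν μ i)) X a ⇔ (at (just (i , a)) ∈ lookup μ X)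
    set⇔ ν μ i X a = subst (λ Q → Q a ⇔ setOn i (lookup μ X) a) (sym (lookup-map X (setOn i) μ)) (mk⇔ id id)

    addPoint-≃ : ∀ (ν : Vec (Node K) m) (μ : Vec (Pred (Node K) 0ℓ) n) i x p →
                 (∀ a → (at (just (i , a)) ≡ x) ⇔ (p ≡ just a)) →
                 chainAt (x ∷ ν) μ i ≃ addPoint p (chainAt ν μ i)
    addPoint-≃ ν μ i x p e = record { points≃ = cons≃ e (λ _ _ → mk⇔ id id) ; sets≃ = λ _ _ → mk⇔ id id }

    addSet-≃ : ∀ (ν : Vec (Node K) m) (μ : Vec (Pred (Node K) 0ℓ) n) i X S →
               (∀ a → at (just (i , a)) ∈ X ⇔ S a) →
               chainAt ν (X ∷ μ) i ≃ addSet S (chainAt ν μ i)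
    addSet-≃ ν μ i X S e = record { points≃ = λ _ _ → mk⇔ id id ; sets≃ = cons≃ e (λ _ _ → mk⇔ id id) }

  -- The Ehrenfeucht-Fraïssé invariant

  module _ {I J : Set} {K K′ : KripkeTree 0} (F : Fan K I) (F′ : Fan K′ J) where
    private
      module F = Fan F
      module F′ = Fan F′

    -- With `q` moves left, colour classes are compared up to `t`. Colours may be finer than types,
    -- so a move only has to refine them. The root lies on no chain, so its membership in sets is
    -- tracked separately.
    record Similar (q t : ℕ) (ν : Vec (Node K) m) (μ : Vec (Pred (Node K) 0ℓ) n)
                   (ν′ : Vec (Node K′) m) (μ′ : Vec (Pred (Node K′) 0ℓ) n) : Set₁ where
      field
        Colour  : Set
        colour  : I → Colour
        colour′ : J → Colour
        typed   : ∀ i j → colour i ≡ colour′ j →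
                  type q (Positions.chainAt F ν μ i) ≡ type q (Positions.chainAt F′ ν′ μ′ j)
        counts  : ∀ γ → (λ i → colour i ≡ γ) ≈[ t ] (λ j → colour′ j ≡ γ)
        roots   : ∀ X → F.at nothing ∈ lookup μ X ⇔ F′.at nothing ∈ lookup μ′ X

  similar-sym : {K K′ : KripkeTree 0} {F : Fan K I} {F′ : Fan K′ J} →
                ∀ {q} {ν : Vec (Node K) m} {μ : Vec (Pred (Node K) 0ℓ) n} {ν′ μ′} →
                Similar F F′ q t ν μ ν′ μ′ → Similar F′ F q t ν′ μ′ ν μ
  similar-sym S = record
    { colour  = colour′
    ; colour′ = colour
    ; typed   = λ i j eq → sym (typed j i (sym eq))
    ; counts  = λ γ → ≈-sym (counts γ)
    ; roots   = λ X → mk⇔ (from (roots X)) (to (roots X))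
    }
    where open Similar S

  -- A set splits each colour class into at most 2 ^ typeSize classes; a point
  -- takes one chain out of its class.
  threshold : ℕ → ℕ → ℕ → ℕ
  threshold zero    m n = 1
  threshold (suc q) m n = 2 ^ typeSize q m (suc n) * threshold q m (suc n) + suc (threshold q (suc m) n)

  threshold-positive : ∀ q m n → 1 ≤ threshold q m n
  threshold-positive zero    m n = ≤-refl
  threshold-positive (suc q) m n =
    ≤-trans (s≤s z≤n) (m≤n+m _ (2 ^ typeSize q m (suc n) * threshold q m (suc n)))

  rank : Formula k m n → ℕ
  rank (P a x)  = 0
  rank (x ≤ᶠ y) = 0
  rank (x ∈ᶠ X) = 0
  rank (¬ᶠ φ)   = rank φ
  rank (φ ∧ᶠ ψ) = rank φ ⊔ rank ψ
  rank (∃¹ φ)   = suc (rank φ)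
  rank (∃² φ)   = suc (rank φ)

  -- Moves of the game

  module Moves {I J : Set} {m n : ℕ} {K K′ : KripkeTree 0} {F : Fan K I} {F′ : Fan K′ J} {q t : ℕ} (1≤t : 1 ≤ t)
    {ν : Vec (Node K) m} {μ : Vec (Pred (Node K) 0ℓ) n}
    {ν′ : Vec (Node K′) m} {μ′ : Vec (Pred (Node K′) 0ℓ) n}
    where
    private
      module F = Fan F
      module F′ = Fan F′
      module C = Positions F
      module C′ = Positions F′

    module _ (S : Similar F F′ q t ν μ ν′ μ′) where
      open Similar S

      partner : ∀ i → ∃[ j ] colour i ≡ colour′ j
      partner i = let j , eq = ≈-inhabited 1≤t (counts (colour i)) refl in j , sym eq

      partner′ : ∀ j → ∃[ i ] colour i ≡ colour′ j
      partner′ j = ≈-inhabited 1≤t (≈-sym (counts (colour′ j))) refl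

      atoms≡ : ∀ i j → colour i ≡ colour′ j → atoms (C.chainAt ν μ i) ≡ atoms (C′.chainAt ν′ μ′ j)
      atoms≡ i j eq = type⇒atoms q (typed i j eq)

      -- A variable away from the root occupies some chain, and an equally coloured chain of the
      -- other fan would then carry it too.
      root-transfer : ∀ x → F.at nothing ≡ lookup ν x → F′.at nothing ≡ lookup ν′ x
      root-transfer x eq with F′.at-onto (lookup ν′ x)
      ... | nothing , eq′ = eq′
      ... | just (j , b) , eq′ with partner′ j
      ... | i , c with point-transfer (C′.chainAt ν′ μ′ j) (C.chainAt ν μ i)
                         (sym (atoms≡ i j c)) x b (from (C′.point⇔ ν′ μ′ j x b) eq′)
      ... | a , p with F.at-injective (trans (to (C.point⇔ ν μ i x a) p) (sym eq))
      ... | ()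

      order-transfer : ∀ x y → Descendant K (lookup ν x) (lookup ν y) → Descendant K′ (lookup ν′ x) (lookup ν′ y)
      order-transfer x y x≤y with F.at-onto (lookup ν x)
      ... | nothing , eq with F′.at-onto (lookup ν′ y)
      ... | p , eqy = subst₂ (Descendant K′) (root-transfer x eq) eqy (from (F′.at-order nothing p) tt)
      order-transfer x y x≤y | just (i , a) , eqx with F.at-onto (lookup ν y)
      ... | nothing , eqy = ⊥-elim (to (F.at-order _ _) (subst₂ (Descendant K) (sym eqx) (sym eqy) x≤y))
      -- Comparable nodes other than the root share a chain, so the atoms of that chain decide.
      ... | just (_ , b) , eqy with to (F.at-order _ _) (subst₂ (Descendant K) (sym eqx) (sym eqy) x≤y)
      ... | refl , a≤b with partner i
      ... | j , c with ordered-transfer (C.chainAt ν μ i) (C′.chainAt ν′ μ′ j) (atoms≡ i j c) x y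
                         (a , b , from (C.point⇔ ν μ i x a) eqx , from (C.point⇔ ν μ i y b) eqy , a≤b)
      ... | a′ , b′ , px , py , a′≤b′ = subst₂ (Descendant K′)
        (to (C′.point⇔ ν′ μ′ j x a′) px) (to (C′.point⇔ ν′ μ′ j y b′) py)
        (from (F′.at-order (just (j , a′)) (just (j , b′))) (refl , a′≤b′))

      membership-transfer : ∀ x X → lookup ν x ∈ lookup μ X → lookup ν′ x ∈ lookup μ′ X
      membership-transfer x X x∈X with F.at-onto (lookup ν x)
      ... | nothing , eq = subst (lookup μ′ X) (root-transfer x eq)
                             (to (roots X) (subst (lookup μ X) (sym eq) x∈X))
      ... | just (i , a) , eq with partner i
      ... | j , c with member-transfer (C.chainAt ν μ i) (C′.chainAt ν′ μ′ j) (atoms≡ i j c) x X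
                         (a , from (C.point⇔ ν μ i x a) eq ,
                          from (C.set⇔ ν μ i X a) (subst (lookup μ X) (sym eq) x∈X))
      ... | a′ , px , pX = subst (lookup μ′ X) (to (C′.point⇔ ν′ μ′ j x a′) px) (to (C′.set⇔ ν′ μ′ j X a′) pX)

    -- Recolour each chain by the type it acquires.
    set-move : ∀ {u} → 2 ^ typeSize q m (suc n) * u ≤ t → 1 ≤ u → Similar F F′ (suc q) t ν μ ν′ μ′ →
               ∀ X → ∃[ X′ ] Similar F F′ q u ν (X ∷ μ) ν′ (X′ ∷ μ′)
    set-move {u} enough 1≤u S X = X′ , record
      { Colour  = Colour × Vec Bool (typeSize q m (suc n))
      ; colour  = λ i → colour i , newType i
      ; colour′ = λ j → colour′ j , newType′ j
      ; typed   = λ i j eq → trans (proj₂ (,-injective eq)) (sym (response-type j))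
      ; counts  = λ { (γ , v) → ≈-resp (λ _ → pair≡) (λ j → pair≡′ j γ v) (proj₂ (recolouring γ) v) }
      ; roots   = λ { zero → root-X′ ; (suc Y) → roots Y }
      }
      where
      open Similar S
      newType : I → Vec Bool (typeSize q m (suc n))
      newType i = type q (C.chainAt ν (X ∷ μ) i)
      recolouring : ∀ γ → Σ[ d ∈ (J → Vec Bool (typeSize q m (suc n))) ]
        (∀ v → (λ i → colour i ≡ γ × newType i ≡ v) ≈[ u ] (λ j → colour′ j ≡ γ × d j ≡ v))
      recolouring γ = ≈-recolour (typeSize q m (suc n)) u newType (≈-≤ enough (counts γ))
      newType′ : J → Vec Bool (typeSize q m (suc n))
      newType′ j = proj₁ (recolouring (colour′ j)) j
      response : ∀ j → ∃[ S′ ] type q (addSet S′ (C′.chainAt ν′ μ′ j)) ≡ newType′ j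
      -- The new class of `j` is inhabited, hence so is its counterpart in the first fan; what `X`
      -- cuts out on a chain `i` there is transferred to `j`.
      response j with ≈-inhabited 1≤u (≈-sym (proj₂ (recolouring (colour′ j)) (newType′ j))) {j} (refl , refl)
      ... | i , c , v with set-transfer q (typed i j c) (λ a → F.at (just (i , a)) ∈ X)
      ... | S′ , eq = S′ , trans (sym eq) v
      X′ : Pred (Node K′) 0ℓ
      X′ y with F′.at-onto y
      ... | nothing      , _ = F.at nothing ∈ X
      ... | just (j , b) , _ = proj₁ (response j) b
      X′-at : ∀ j b → F′.at (just (j , b)) ∈ X′ ⇔ proj₁ (response j) b
      X′-at j b with F′.at-onto (F′.at (just (j , b)))
      ... | p , eq with F′.at-injective eq
      ... | refl = mk⇔ id id
      root-X′ : F.at nothing ∈ X ⇔ F′.at nothing ∈ X′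
      root-X′ with F′.at-onto (F′.at nothing)
      ... | p , eq with F′.at-injective eq
      ... | refl = mk⇔ id id
      response-type : ∀ j → type q (C′.chainAt ν′ (X′ ∷ μ′) j) ≡ newType′ j
      response-type j = trans (type-cong q (C′.addSet-≃ ν′ μ′ j X′ _ (X′-at j))) (proj₂ (response j))
      pair≡ : ∀ {C D : Set} {c γ : C} {d v : D} → (c ≡ γ × d ≡ v) ⇔ ((c , d) ≡ (γ , v))
      pair≡ = mk⇔ (λ { (refl , refl) → refl }) ,-injective
      pair≡′ : ∀ j γ v → (colour′ j ≡ γ × proj₁ (recolouring γ) j ≡ v) ⇔ ((colour′ j , newType′ j) ≡ (γ , v))
      pair≡′ j γ v = mk⇔ (λ { (refl , refl) → refl }) (λ { refl → refl , refl })

    -- A point at the root misses every chain, so the colouring stays as it is.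
    root-move : ∀ {u} → u ≤ t → Similar F F′ (suc q) t ν μ ν′ μ′ →
                Similar F F′ q u (F.at nothing ∷ ν) μ (F′.at nothing ∷ ν′) μ′
    root-move u≤t S = record
      { colour  = colour
      ; colour′ = colour′
      ; typed   = λ i j c → trans (type-cong q (C.addPoint-≃ ν μ i _ nothing λ a → absent F))
                    (trans (no-point-transfer q (typed i j c))
                      (sym (type-cong q (C′.addPoint-≃ ν′ μ′ j _ nothing λ a → absent F′))))
      ; counts  = λ γ → ≈-≤ u≤t (counts γ)
      ; roots   = roots
      }
      where
      open Similar S
      absent : ∀ {K : KripkeTree 0} (G : Fan K A) {p} →
               (Fan.at G (just p) ≡ Fan.at G nothing) ⇔ (nothing ≡ just (proj₂ p))
      absent G = mk⇔ (λ eq → case Fan.at-injective G eq of λ ()) (λ ())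

    -- The chain that receives the point gets a colour of its own.
    point-move : ∀ {u} → suc u ≤ t → Similar F F′ (suc q) t ν μ ν′ μ′ → ∀ i a →
                 ∃[ y ] Similar F F′ q u (F.at (just (i , a)) ∷ ν) μ (y ∷ ν′) μ′
    point-move {u} enough S i₀ a = go
      where
      open Similar S
      mark : {A : Set} → A → (A → Colour) → A → Maybe Colour
      mark x₀ c x with em _ {x ≡ x₀}
      ... | yes _ = nothing
      ... | no  _ = just (c x)
      mark-nothing : {A : Set} (x₀ : A) (c : A → Colour) → ∀ x → (x ≡ x₀) ⇔ (mark x₀ c x ≡ nothing)
      mark-nothing x₀ c x with em _ {x ≡ x₀}
      ... | yes eq = mk⇔ (λ _ → refl) (λ _ → eq)
      ... | no neq = mk⇔ (λ eq → contradiction eq neq) (λ ())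
      mark-just : {A : Set} (x₀ : A) (c : A → Colour) → ∀ γ x → (c x ≡ γ × x ≢ x₀) ⇔ (mark x₀ c x ≡ just γ)
      mark-just x₀ c γ x with em _ {x ≡ x₀}
      ... | yes eq = mk⇔ (λ (_ , neq) → contradiction eq neq) (λ ())
      ... | no neq = mk⇔ (λ (eq , _) → cong just eq) (λ { refl → refl , neq })
      singletons : {A B : Set} {x : A} {y : B} → (_≡ x) ≈[ u ] (_≡ y)
      singletons = ≈-≤ (n≤1+n u) (≈-∖⁻ refl refl (≈-empty (λ _ (eq , neq) → neq eq) (λ _ (eq , neq) → neq eq)))
      hit : {K : KripkeTree 0} (G : Fan K A) {i : A} {a b : ℕ} →
            (Fan.at G (just (i , b)) ≡ Fan.at G (just (i , a))) ⇔ (just a ≡ just b)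
      hit G = mk⇔ (λ eq → case Fan.at-injective G eq of λ { refl → refl }) (λ { refl → refl })
      miss : {K : KripkeTree 0} (G : Fan K A) {i j : A} {a b : ℕ} → i ≢ j →
             (Fan.at G (just (i , b)) ≡ Fan.at G (just (j , a))) ⇔ (nothing ≡ just b)
      miss G i≢j = mk⇔ (λ eq → case Fan.at-injective G eq of λ { refl → contradiction refl i≢j }) (λ ())
      go : ∃[ y ] Similar F F′ q u (F.at (just (i₀ , a)) ∷ ν) μ (y ∷ ν′) μ′
      go with ≈-inhabited 1≤t (counts (colour i₀)) refl
      ... | j₀ , c₀ with new-point-transfer q (typed i₀ j₀ (sym c₀)) a
      ... | b , eq = F′.at (just (j₀ , b)) , record
        { Colour  = Maybe Colour
        ; colour  = mark i₀ colour
        ; colour′ = mark j₀ colour′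
        ; typed   = typed₂
        ; counts  = counts₂
        ; roots   = roots
        }
        where
        typed₂ : ∀ i j → mark i₀ colour i ≡ mark j₀ colour′ j →
                 type q (C.chainAt (F.at (just (i₀ , a)) ∷ ν) μ i) ≡
                 type q (C′.chainAt (F′.at (just (j₀ , b)) ∷ ν′) μ′ j)
        typed₂ i j c with em _ {i ≡ i₀} | em _ {j ≡ j₀}
        typed₂ i j c | yes refl | yes refl =
          trans (type-cong q (C.addPoint-≃ ν μ i _ (just a) λ _ → hit F))
            (trans eq (sym (type-cong q (C′.addPoint-≃ ν′ μ′ j _ (just b) λ _ → hit F′))))
        typed₂ i j c | no i≢ | no j≢ =
          trans (type-cong q (C.addPoint-≃ ν μ i _ nothing λ _ → miss F i≢))
            (trans (no-point-transfer q (typed i j (just-injective c)))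
              (sym (type-cong q (C′.addPoint-≃ ν′ μ′ j _ nothing λ _ → miss F′ j≢))))
        counts₂ : ∀ γ → (λ i → mark i₀ colour i ≡ γ) ≈[ u ] (λ j → mark j₀ colour′ j ≡ γ)
        counts₂ nothing  = ≈-resp (mark-nothing i₀ colour) (mark-nothing j₀ colour′) singletons
        counts₂ (just γ) = ≈-resp (mark-just i₀ colour γ) (mark-just j₀ colour′ γ) rest
          where
          rest : (λ i → colour i ≡ γ × i ≢ i₀) ≈[ u ] (λ j → colour′ j ≡ γ × j ≢ j₀)
          -- Only the common class of `i₀` and `j₀` shrinks, by one chain in each fan, which costs
          -- one unit of the threshold.
          rest with em _ {colour i₀ ≡ γ}
          ... | yes hit₀ = ≈-∖ hit₀ (trans c₀ hit₀) (≈-≤ enough (counts γ))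
          ... | no  away = ≈-resp
            (λ i → mk⇔ (λ c → c , λ { refl → away c }) proj₁)
            (λ j → mk⇔ (λ c → c , λ { refl → away (trans (sym c₀) c) }) proj₁)
            (≈-≤ (≤-trans (n≤1+n u) enough) (counts γ))

  -- Each quantifier is answered by a move. One implication suffices, because `Similar` is symmetric
  -- and negation swaps the fans. `P` has no case, as `Fin 0` is empty.
  sat-transfer : {K K′ : KripkeTree 0} (F : Fan K I) (F′ : Fan K′ J) →
    ∀ q {ν : Vec (Node K) m} {μ : Vec (Pred (Node K) 0ℓ) n}
    {ν′ : Vec (Node K′) m} {μ′ : Vec (Pred (Node K′) 0ℓ) n}
    (φ : Formula 0 m n) → rank φ ≤ q → Similar F F′ q (threshold q m n) ν μ ν′ μ′ →
    Semantics.Sat MSO K ν μ φ → Semantics.Sat MSO K′ ν′ μ′ φ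
  sat-transfer {m = m} {n} F F′ q (x ≤ᶠ y) _ S (lift s) =
    lift (Moves.order-transfer (threshold-positive q m n) S x y s)
  sat-transfer {m = m} {n} F F′ q (x ∈ᶠ X) _ S (lift s) =
    lift (Moves.membership-transfer (threshold-positive q m n) S x X s)
  sat-transfer F F′ q (¬ᶠ φ) r S ¬s s = ¬s (sat-transfer F′ F q φ r (similar-sym S) s)
  sat-transfer F F′ q (φ ∧ᶠ ψ) r S (s , t) =
    sat-transfer F F′ q φ (≤-trans (m≤m⊔n _ _) r) S s ,
    sat-transfer F F′ q ψ (≤-trans (m≤n⊔m (rank φ) _) r) S t
  sat-transfer {m = m} {n} F F′ (suc q) (∃¹ φ) (s≤s r) S (x , s) with Fan.at-onto F x
  ... | nothing , refl = _ , sat-transfer F F′ q φ r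
    (Moves.root-move (threshold-positive (suc q) m n)
      (≤-trans (n≤1+n _) (m≤n+m _ (2 ^ typeSize q m (suc n) * threshold q m (suc n)))) S) s
  ... | just (i , a) , refl =
    let y , S′ = Moves.point-move (threshold-positive (suc q) m n)
                   (m≤n+m _ (2 ^ typeSize q m (suc n) * threshold q m (suc n))) S i a
    in y , sat-transfer F F′ q φ r S′ s
  sat-transfer {m = m} {n} F F′ (suc q) (∃² φ) (s≤s r) S (X , _ , s) =
    let X′ , S′ = Moves.set-move (threshold-positive (suc q) m n)
                    (m≤m+n _ _) (threshold-positive q m (suc n)) S X
    in X′ , tt , sat-transfer F F′ q φ r S′ s

  -- Fans as trees of words

  module FanTree {I : Set} (i₀ : I) (index : I → ℕ) (index-injective : ∀ {i j} → index i ≡ index j → i ≡ j) where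

    OnFan : Pred Word 0ℓ
    OnFan w = w ≡ [] ⊎ ∃[ i ] ∃[ a ] w ≡ index i ∷ replicate a 0

    replicate-⊑ : ∀ a {σ} → σ ⊑ replicate a 0 → σ ≡ replicate (length σ) 0
    replicate-⊑ a       {[]}    _        = refl
    replicate-⊑ zero    {_ ∷ _} (_ , ())
    replicate-⊑ (suc a) {_ ∷ _} (ρ , eq) with ∷-injective eq
    ... | refl , eq′ = cong (0 ∷_) (replicate-⊑ a (ρ , eq′))

    ⊑-replicate : ∀ {a b} → a ≤ b → replicate a 0 ⊑ replicate b 0
    ⊑-replicate {b = b} z≤n = replicate b 0 , refl
    ⊑-replicate (s≤s a≤b) with ⊑-replicate a≤b
    ... | ρ , eq = ρ , cong (0 ∷_) eq

    onFan-prefix : ∀ {σ τ} → OnFan τ → σ ⊑ τ → OnFan σ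
    onFan-prefix {[]}    _           _          = inj₁ refl
    onFan-prefix {_ ∷ σ} (inj₁ refl) (_ , ())
    onFan-prefix {_ ∷ σ} (inj₂ (i , a , refl)) (ρ , eq) with ∷-injective eq
    ... | refl , eq′ = inj₂ (i , length σ , cong (index i ∷_) (replicate-⊑ a (ρ , eq′)))

    fanTree : Tree
    fanTree = record
      { Nodes         = OnFan
      ; root          = []
      ; root∈         = inj₁ refl
      ; rooted        = λ τ _ → τ , refl
      ; prefix-closed = λ _ _ → onFan-prefix
      }

    open Tree fanTree using (Child)

    place : Maybe (I × ℕ) → Tree.Node fanTree
    place nothing        = [] ,ᴿ [ inj₁ refl ]
    place (just (i , a)) = (index i ∷ replicate a 0) ,ᴿ [ inj₂ (i , a , refl) ]

    place-onto : ∀ x → ∃[ p ] place p ≡ x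
    place-onto (w ,ᴿ [ w∈ ]) with recompute (em _) w∈
    ... | inj₁ refl           = nothing , refl
    ... | inj₂ (i , a , refl) = just (i , a) , refl

    succ : Maybe (I × ℕ) → Maybe (I × ℕ)
    -- The root needs a child, so some chain has to exist; `i₀` names one.
    succ nothing        = just (i₀ , 0)
    succ (just (i , a)) = just (i , suc a)

    replicate-∷ʳ : ∀ a → replicate (suc a) 0 ≡ replicate a 0 ∷ʳ 0
    replicate-∷ʳ zero    = refl
    replicate-∷ʳ (suc a) = cong (0 ∷_) (replicate-∷ʳ a)

    succ-child : ∀ p → Child (place p) (place (succ p))
    succ-child nothing        = index i₀ , refl
    succ-child (just (i , a)) = 0 , cong (index i ∷_) (replicate-∷ʳ a)

    fan : KripkeTree 0
    fan = record
      { tree        = fanTree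
      ; nonBlocking = λ x → let p , eq = place-onto x in
                            place (succ p) , subst (λ y → Child y (place (succ p))) eq (succ-child p)
      ; Lab         = λ _ → []
      }

    place-⊑ : ∀ p r → value (place p) ⊑ value (place r) → p ≼ r
    place-⊑ nothing        _              _          = tt
    place-⊑ (just _)       nothing        (_ , ())
    place-⊑ (just (i , a)) (just (j , b)) (ρ , eq) with ∷-injective eq
    ... | eqi , eqa = sym (index-injective eqi) ,
      subst₂ _≤_ (length-replicate a) (length-replicate b) (⊑-length {replicate a 0} {replicate b 0} (ρ , eqa))

    ⊑-place : ∀ p r → p ≼ r → value (place p) ⊑ value (place r)
    ⊑-place nothing        r              _            = value (place r) , refl
    ⊑-place (just (i , a)) (just (j , b)) (refl , a≤b) with ⊑-replicate a≤b
    ... | ρ , eq = ρ , cong (index i ∷_) eq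

    ≼-antisym : ∀ {p r : Maybe (I × ℕ)} → p ≼ r → r ≼ p → p ≡ r
    ≼-antisym {nothing} {nothing} _ _ = refl
    ≼-antisym {nothing} {just _} _ ()
    ≼-antisym {just _}  {just _} (refl , a≤b) (_ , b≤a) = cong (λ c → just (_ , c)) (≤-antisym a≤b b≤a)

    place-injective : ∀ {p r} → place p ≡ place r → p ≡ r
    place-injective {p} {r} eq = ≼-antisym
      (place-⊑ p r (subst (λ y → value (place p) ⊑ value y) eq ⊑-refl))
      (place-⊑ r p (subst (λ y → value y ⊑ value (place p)) eq ⊑-refl))

    isFan : Fan fan I
    isFan = record
      { at           = place
      ; at-onto      = place-onto
      ; at-injective = place-injective
      ; at-order     = λ p r → mk⇔ (place-⊑ p r) (⊑-place p r)
      }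

  -- Infinite branching in coWMSO

  manyChildren : Sentence 0
  manyChildren = ∃² (∀¹ (zero ∈ᶠ zero ⇒ᶠ
    -- A node above an element `x` of the infinite set is `x` itself or the root, so the set
    -- consists of children of the root and possibly the root.
    (∀¹ (zero ≤ᶠ suc zero ⇒ᶠ suc zero ≤ᶠ zero ∨ᶠ (∀¹ (suc zero ≤ᶠ zero))))))

  module ManyChildren {K : KripkeTree 0} (F : Fan K I) where
    open Fan F
    open Semantics coWMSO K

    heads-infinite⇒sat : ¬ Finite (λ x → ∃[ i ] at (just (i , 0)) ≡ x) → K ⊨[ coWMSO ] manyChildren
    heads-infinite⇒sat inf = (λ x → ∃[ i ] at (just (i , 0)) ≡ x) , inf ,
      from ∀-classical λ x → from ⇒-classical λ x∈X → from ∀-classical λ z → from ⇒-classical λ z≤x →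
      from ∨-classical (onlyRootAbove x z (lower x∈X) (lower z≤x))
      where
      onlyRootAbove : ∀ x z → ∃[ i ] at (just (i , 0)) ≡ x → Descendant K z x →
        Lift (lsuc 0ℓ) (Descendant K x z) ⊎ (¬ (Σ[ w ∈ Node K ] ¬ Lift (lsuc 0ℓ) (Descendant K z w)))
      onlyRootAbove x z (i , refl) z≤x with at-onto z
      ... | nothing , refl = inj₂ (from ∀-classical λ w → let p , eq = at-onto w in
              lift (subst (Descendant K (at nothing)) eq (from (at-order nothing p) tt)))
      ... | just (j , a) , refl with to (at-order _ _) z≤x
      ... | refl , z≤n = inj₁ (lift z≤x)

    sat⇒heads-infinite : K ⊨[ coWMSO ] manyChildren → ¬ Finite (λ x → ∃[ i ] at (just (i , 0)) ≡ x)
    sat⇒heads-infinite (X , inf , s) fin = inf (finite-∪ split (at nothing ∷ [] , λ _ → here) fin)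
      where
      split : ∀ x → x ∈ X → x ≡ at nothing ⊎ ∃[ i ] at (just (i , 0)) ≡ x
      split x x∈X with at-onto x
      ... | nothing , refl = inj₁ refl
      -- Taking the first node of the chain of `x` as the node above `x` forces `x` to be that node,
      -- which is not the root.
      ... | just (i , a) , refl with to ∨-classical (to ⇒-classical (to ∀-classical
              (to ⇒-classical (to ∀-classical s (at (just (i , a)))) (lift x∈X)) (at (just (i , 0))))
              (lift (from (at-order (just (i , 0)) (just (i , a))) (refl , z≤n))))
      ... | inj₁ x≤z with to (at-order _ _) (lower x≤z)
      ... | _ , z≤n = inj₂ (i , refl)
      split x x∈X | just (i , a) , refl | inj₂ z≤all =
        ⊥-elim (to (at-order (just (i , 0)) nothing) (lower (to ∀-classical z≤all (at nothing))))

  module ℕFan = FanTree {ℕ} 0 id id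
  module FinFan (N : ℕ) = FanTree {Fin (suc N)} zero toℕ toℕ-injective

  -- Before any variable is assigned all chains have the same type, so one colour suffices; both
  -- fans have at least as many chains as the threshold.
  fans-similar : ∀ q N → threshold q 0 0 ≤ N → Similar ℕFan.isFan (FinFan.isFan N) q (threshold q 0 0) [] [] [] []
  fans-similar q N t≤N = record
    { Colour  = ⊤
    ; colour  = λ _ → tt
    ; colour′ = λ _ → tt
    ; typed   = λ _ _ _ → refl
    ; counts  = λ _ s s≤t → mk⇔
        (λ _ → atLeast-injection s (λ i → inject≤ i (≤-trans s≤t (≤-trans t≤N (n≤1+n N))))
                 (λ {i} {j} → inject≤-injective _ _ i j) λ _ → refl)
        (λ _ → atLeast-injection s toℕ toℕ-injective λ _ → refl)
    ; roots   = λ ()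
    }

  coWMSO≰MSO : ¬ (coWMSO ≤[ AllKripkeTrees ] MSO)
  coWMSO≰MSO le with le 0 manyChildren
  ... | φ , equivalent = sat⇒heads-infinite finSat finitelyMany
    where
    q = rank φ
    -- With this many chains, a sentence of rank `q` that holds in the infinite fan also holds in
    -- the finite one.
    N = threshold q 0 0
    open FinFan N using (place; isFan; fan)
    open ManyChildren isFan using (sat⇒heads-infinite)
    ℕSat : ℕFan.fan ⊨[ coWMSO ] manyChildren
    ℕSat = ManyChildren.heads-infinite⇒sat ℕFan.isFan (unbounded⇒¬finite head λ b →
      ℕFan.place (just (b , 0)) , (b , refl) , ≤-refl)
      where
      head : Tree.Node ℕFan.fanTree → ℕ
      head x with value x
      ... | []    = 0
      ... | i ∷ _ = i
    finSat : fan ⊨[ coWMSO ] manyChildren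
    finSat = from (equivalent fan tt) (sat-transfer ℕFan.isFan isFan q φ ≤-refl (fans-similar q N ≤-refl)
               (to (equivalent ℕFan.fan tt) ℕSat))
    finitelyMany : Finite (λ x → ∃[ i ] place (just (i , 0)) ≡ x)
    finitelyMany = List.map (λ i → place (just (i , 0))) (allFin (suc N)) ,
      λ { _ (i , refl) → ∈-map⁺ (λ i → place (just (i , 0))) (∈-allFin i) }

theorem6 : (∀ ℓ → ExcludedMiddle ℓ) →
    (MSO <[ AllKripkeTrees ] coWMSO) ×
    (WMSO <[ AllKripkeTrees ] coWMSO) ×
    (MSO ≡[ FinitelyBranchingKripkeTrees ] coWMSO) ×
    (WMSO <[ FinitelyBranchingKripkeTrees ] coWMSO)
theorem6 em =
  (MSO≤coWMSO , coWMSO≰MSO) ,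
  (WMSO≤coWMSO , coWMSO≰WMSO ∘ restrict) ,
  (restrict MSO≤coWMSO , coWMSO≤MSO) ,
  (restrict WMSO≤coWMSO , coWMSO≰WMSO)
  where
  open Classical em
  restrict : ∀ {L L′} → L ≤[ AllKripkeTrees ] L′ → L ≤[ FinitelyBranchingKripkeTrees ] L′
  restrict le k φ = let ψ , equivalent = le k φ in ψ , λ K _ → equivalent K tt
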